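{- Let $k,t$ be positive integers with $k\geq 4$. Then $$\mathrm{ex}_k(n,\mathbb{P}^{(k)}_{2t+1})\leq\mathrm{ex}_k(n,\mathbb{P}^{(k)}_{2t+2})\leq t\binom{n-1}{k-1}+O(n^{k-2}),$$ where the implied constant depends only on $k$ and $t$.
   Context: A $k$-uniform linear path of length $\ell$, $\mathbb{P}^{(k)}_\ell$, is a family of $k$-sets $\{F_1,\ldots,F_\ell\}$ with $|F_i\cap F_{i+1}|=1$ for each $i$ and $F_i\cap F_j=\emptyset$ whenever $|i-j|>1$. $\mathrm{ex}_k(n,H)$ is the maximum number of members of a family $\mathcal{F}\subseteq\binom{[n]}{k}$ containing no subfamily isomorphic to $H$. -}

module Defs where

open import Data.Nat using (ℕ; suc; _≤_; _<_)
open import Data.Fin using (Fin; toℕ)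
open import Data.Fin.Subset using (Subset; _∩_; ∣_∣; Empty)
open import Data.List using (List; length)
open import Data.List.Membership.Propositional using (_∈_)
open import Data.List.Relation.Unary.All using (All)
open import Data.List.Relation.Unary.Unique.Propositional using (Unique)
open import Data.Product using (Σ; _×_)
open import Relation.Binary.PropositionalEquality using (_≡_)
open import Relation.Nullary using (¬_)

IsKFamily : (k n : ℕ) → List (Subset n) → Set
IsKFamily k n F = Unique F × All (λ s → ∣ s ∣ ≡ k) F

IsLinearPath : {n : ℕ} (ℓ : ℕ) → (Fin ℓ → Subset n) → Set
IsLinearPath ℓ P =
  (∀ i j → toℕ j ≡ suc (toℕ i) → ∣ P i ∩ P j ∣ ≡ 1) ×
  (∀ i j → suc (toℕ i) < toℕ j → Empty (P i ∩ P j))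

ContainsLinearPath : {n : ℕ} (ℓ : ℕ) → List (Subset n) → Set
ContainsLinearPath ℓ F =
  Σ (Fin _ → _) λ P → IsLinearPath ℓ P × (∀ i → P i ∈ F)

PathFree : (k n ℓ : ℕ) → List (Subset n) → Set
PathFree k n ℓ F = IsKFamily k n F × ¬ ContainsLinearPath ℓ F

IsEx : (k n ℓ m : ℕ) → Set
IsEx k n ℓ m =
  Σ (List (Subset n)) (λ F → PathFree k n ℓ F × length F ≡ m) ×
  (∀ (F : List (Subset n)) → PathFree k n ℓ F → length F ≤ m)

{-# OPTIONS --safe #-}
module Submission where

-- Write ℓ = 2t + 2 and call two vertices linked if, for every small set W avoiding both,
-- some edge of F contains both and misses W.  A path with ℓ edges in the graph of linked
-- pairs expands greedily to a linear path of length ℓ in F.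
--
-- Enumerate the edges as k-tuples.  A family of more than c·n^(k-2) tuples has a nonempty
-- subfamily and a set U of positions such that in every tuple of it each entry outside U,
-- and each pair of entries in U, can be replaced avoiding any small set.  If U has two
-- elements u, u′ then, since k ≥ 4, there are two further positions; keeping one of them
-- fixed all other entries can be moved away, and alternating between the two gives a linear
-- path.  Otherwise U is contained in one position, and the vertex y at that position of an
-- edge e is linked to every other vertex of e.  So all but O(n^(k-2)) edges e of a path-free
-- F have such a centre y.
--
-- If there are more than t·C(n,k-1) + O(n) centred edges, then deleting those with at most t
-- edges over e - y, or with at most 2^ℓ edges centred at y, leaves a nonempty family.  Its
-- centres are linked to vertices outside any ℓ given ones, and every vertex of an e - y is
-- linked to more than t centres.  Pósa rotations then produce a path with ℓ edges among linked pairs.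

open import Defs
open import Level using (0ℓ)
open import Data.Nat using (ℕ; zero; suc; _+_; _*_; _∸_; _^_; _≤_; _<_; z≤n; s≤s; _<?_)
open import Data.Nat.Properties
open import Data.Nat.Solver using (module +-*-Solver)
open import Data.Nat.Combinatorics using (_C_; nCk+nC[k+1]≡[n+1]C[k+1])
open import Data.Bool using (Bool; true; false)
import Data.Bool.Properties as Bool
open import Data.Fin using (Fin; zero; suc; toℕ; punchIn; punchOut)
import Data.Fin.Properties as Fin
open import Data.Fin.Subset as Subset using (Subset; inside; outside; ⁅_⁆; _∩_; _∪_; _-_; ∣_∣; Empty)
import Data.Fin.Subset.Properties as Subset
open import Data.Vec as Vec using (Vec; []; _∷_; removeAt; fromList)
import Data.Vec.Properties as Vec
open import Data.List using (List; []; _∷_; [_]; _++_; _ʳ++_; _∷ʳ_; reverse; length; map; filter; concatMap; allFin; cartesianProduct; cartesianProductWith; lookup)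
open import Data.List.Properties
open import Data.List.Membership.Propositional using (_∈_; _∉_; find)
open import Data.List.Membership.Propositional.Properties
open import Data.List.Relation.Unary.All as All using (All; []; _∷_)
import Data.List.Relation.Unary.All.Properties as All
open import Data.List.Relation.Unary.Any as Any using (Any; here; there)
import Data.List.Relation.Unary.Any.Properties as Any
open import Data.List.Relation.Unary.AllPairs using ([]; _∷_)
open import Data.List.Relation.Unary.Linked as Linked using (Linked; []; [-]; _∷_)
open import Data.List.Relation.Unary.Unique.Propositional using (Unique)
import Data.List.Relation.Unary.Unique.Propositional.Properties as Unique
open import Data.List.Relation.Binary.Permutation.Propositional using (_↭_; ↭-refl; ↭-sym; ↭-trans; prep; ↭⇒↭ₛ)
import Data.List.Relation.Binary.Permutation.Propositional.Properties as Perm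
import Data.List.Relation.Binary.Permutation.Setoid.Properties as PermSetoid
import Data.Product.Properties as Product
import Data.Sum.Properties as Sum
open import Data.Product using (Σ; ∃; ∃₂; _×_; _,_; proj₁; proj₂)
open import Data.Sum using (_⊎_; inj₁; inj₂; [_,_]′)
open import Data.Empty using (⊥; ⊥-elim)
open import Data.Unit using (⊤; tt)
open import Function using (_∘_; id)
open import Relation.Binary.Definitions using (DecidableEquality)
open import Relation.Binary.PropositionalEquality hiding ([_])
open import Relation.Nullary using (¬_; Dec; yes; no; contradiction; ¬?; _×-dec_; _⊎-dec_)
open import Relation.Nullary.Decidable using (decidable-stable)
open import Relation.Unary using (Pred; Decidable)

private
  variable
    A B : Set

-- Counting in lists

count : {P : Pred A 0ℓ} → Decidable P → List A → ℕ
count P? xs = length (filter P? xs)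

count-reject : {P : Pred A 0ℓ} (P? : Decidable P) {x : A} {xs : List A} →
               ¬ P x → count P? (x ∷ xs) ≡ count P? xs
count-reject P? ¬px = cong length (filter-reject P? ¬px)

count-mono : {P Q : Pred A 0ℓ} (P? : Decidable P) (Q? : Decidable Q) (xs : List A) →
             (∀ {x} → x ∈ xs → P x → Q x) → count P? xs ≤ count Q? xs
count-mono P? Q? [] P⇒Q = z≤n
count-mono P? Q? (x ∷ xs) P⇒Q with P? x | Q? x | count-mono P? Q? xs (P⇒Q ∘ there)
... | yes p | yes q | ih = s≤s ih
... | yes p | no ¬q | ih = contradiction (P⇒Q (here refl) p) ¬q
... | no ¬p | yes q | ih = m≤n⇒m≤1+n ih
... | no ¬p | no ¬q | ih = ih

count-filter-≤ : {P Q : Pred A 0ℓ} (P? : Decidable P) (Q? : Decidable Q) (xs : List A) →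
                 count P? (filter Q? xs) ≤ count P? xs
count-filter-≤ P? Q? [] = z≤n
count-filter-≤ P? Q? (x ∷ xs) with Q? x
... | yes _ with P? x
...   | yes _ = s≤s (count-filter-≤ P? Q? xs)
...   | no _  = count-filter-≤ P? Q? xs
count-filter-≤ P? Q? (x ∷ xs) | no _ with P? x
...   | yes _ = m≤n⇒m≤1+n (count-filter-≤ P? Q? xs)
...   | no _  = count-filter-≤ P? Q? xs

count-map : {P : Pred B 0ℓ} (P? : Decidable P) (f : A → B) (xs : List A) →
            count P? (map f xs) ≡ count (P? ∘ f) xs
count-map P? f [] = refl
count-map P? f (x ∷ xs) with P? (f x)
... | yes _ = cong suc (count-map P? f xs)
... | no _  = count-map P? f xs

count-↭ : {P : Pred A 0ℓ} (P? : Decidable P) {xs ys : List A} → xs ↭ ys → count P? xs ≡ count P? ys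
count-↭ P? xs↭ys = Perm.↭-length (Perm.filter-↭ P? xs↭ys)

length-split : {P : Pred A 0ℓ} (P? : Decidable P) (xs : List A) →
               length xs ≡ count P? xs + length (filter (¬? ∘ P?) xs)
length-split P? [] = refl
length-split P? (x ∷ xs) with P? x
... | yes _ = cong suc (length-split P? xs)
... | no _  = trans (cong suc (length-split P? xs)) (sym (+-suc _ _))

-- Union bound: the entries satisfying `Q b` for the first `b` are split off, and the rest is
-- covered by the remaining ones. The properties `Q b` may overlap.
length≤cover : {Q : B → Pred A 0ℓ} (Q? : ∀ b → Decidable (Q b)) {d : ℕ} (bs : List B) (as : List A) →
               (∀ {a} → a ∈ as → Any (λ b → Q b a) bs) →
               (∀ {b} → b ∈ bs → count (Q? b) as ≤ d) →
               length as ≤ length bs * d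
length≤cover Q? [] [] cov small = z≤n
length≤cover Q? [] (a ∷ as) cov small with () ← cov (here refl)
length≤cover {Q = Q} Q? {d} (b ∷ bs) as cov small = begin
  length as                          ≡⟨ length-split (Q? b) as ⟩
  count (Q? b) as + length rest      ≤⟨ +-mono-≤ (small (here refl))
                                          (length≤cover Q? bs rest cov′
                                            (λ {c} c∈bs → ≤-trans (count-filter-≤ (Q? c) _ as) (small (there c∈bs)))) ⟩
  d + length bs * d                  ∎
  where
  open ≤-Reasoning
  rest = filter (¬? ∘ Q? b) as
  cov′ : ∀ {a} → a ∈ rest → Any (λ c → Q c a) bs
  cov′ a∈rest with ∈-filter⁻ (¬? ∘ Q? b) {xs = as} a∈rest
  ... | a∈as , ¬q with cov a∈as
  ...   | here q = contradiction q ¬q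
  ...   | there any = any

count-unique-≤1 : {P : Pred A 0ℓ} (P? : Decidable P) {xs : List A} → Unique xs →
                  (∀ {x y} → x ∈ xs → y ∈ xs → P x → P y → x ≡ y) → count P? xs ≤ 1
count-unique-≤1 P? {xs} uniq inj
  with filter P? xs | Unique.filter⁺ P? uniq | (λ {v} → ∈-filter⁻ P? {v} {xs})
... | []         | _                 | _    = z≤n
... | _ ∷ []     | _                 | _    = s≤s z≤n
... | x ∷ y ∷ _  | (x≢y ∷ _) ∷ _     | from =
  contradiction (inj (proj₁ x∈) (proj₁ y∈) (proj₂ x∈) (proj₂ y∈)) x≢y
  where
  x∈ = from (here refl)
  y∈ = from (there (here refl))

unique-⊆⇒length≤ : DecidableEquality A → {xs ys : List A} → Unique xs →
                   (∀ {x} → x ∈ xs → x ∈ ys) → length xs ≤ length ys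
unique-⊆⇒length≤ _≟_ {xs} {ys} uniq xs⊆ys =
  subst (length xs ≤_) (*-identityʳ _)
    (length≤cover (λ y x → x ≟ y) ys xs xs⊆ys
      (λ _ → count-unique-≤1 (_≟ _) uniq (λ _ _ p q → trans p (sym q))))

unique-⊆⇒count≤ : DecidableEquality A → {P : Pred A 0ℓ} (P? : Decidable P) {xs ys : List A} → Unique xs →
                  (∀ {x} → x ∈ xs → x ∈ ys) → count P? xs ≤ count P? ys
unique-⊆⇒count≤ _≟_ P? {xs} uniq xs⊆ys = unique-⊆⇒length≤ _≟_ (Unique.filter⁺ P? uniq) λ x∈ →
  let x∈xs , px = ∈-filter⁻ P? {xs = xs} x∈ in ∈-filter⁺ P? (xs⊆ys x∈xs) px

unique-resp-↭ : {xs ys : List A} → xs ↭ ys → Unique xs → Unique ys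
unique-resp-↭ p = PermSetoid.Unique-resp-↭ (setoid _) (↭⇒↭ₛ p)

-- Enumerations

allVecs : List A → (m : ℕ) → List (Vec A m)
allVecs as zero    = [ [] ]
allVecs as (suc m) = cartesianProductWith _∷_ as (allVecs as m)

length-cartesianProductWith : {C : Set} (f : A → B → C) (as : List A) (bs : List B) →
                              length (cartesianProductWith f as bs) ≡ length as * length bs
length-cartesianProductWith f []       bs = refl
length-cartesianProductWith f (a ∷ as) bs =
  trans (length-++ (map (f a) bs)) (cong₂ _+_ (length-map (f a) bs) (length-cartesianProductWith f as bs))

length-allVecs : (as : List A) (m : ℕ) → length (allVecs as m) ≡ length as ^ m
length-allVecs as zero    = refl
length-allVecs as (suc m) =
  trans (length-cartesianProductWith _∷_ as (allVecs as m)) (cong (length as *_) (length-allVecs as m))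

∈-allVecs : {as : List A} → (∀ a → a ∈ as) → ∀ {m} (v : Vec A m) → v ∈ allVecs as m
∈-allVecs every []      = here refl
∈-allVecs every (a ∷ v) = ∈-cartesianProductWith⁺ _∷_ (every a) (∈-allVecs every v)

-- The recursion is Pascal's rule, so that the length is the binomial coefficient.
subsetsOfSize : (n j : ℕ) → List (Subset n)
subsetsOfSize zero    zero    = [ [] ]
subsetsOfSize zero    (suc j) = []
subsetsOfSize (suc n) zero    = map (outside ∷_) (subsetsOfSize n zero)
subsetsOfSize (suc n) (suc j) =
  map (inside ∷_) (subsetsOfSize n j) ++ map (outside ∷_) (subsetsOfSize n (suc j))

length-subsetsOfSize : ∀ n j → length (subsetsOfSize n j) ≡ n C j
length-subsetsOfSize zero    zero    = refl
length-subsetsOfSize zero    (suc j) = refl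
length-subsetsOfSize (suc n) zero    =
  trans (length-map (outside ∷_) (subsetsOfSize n zero)) (length-subsetsOfSize n zero)
length-subsetsOfSize (suc n) (suc j) = begin
  length (map (inside ∷_) S ++ map (outside ∷_) T)             ≡⟨ length-++ (map (inside ∷_) S) ⟩
  length (map (inside ∷_) S) + length (map (outside ∷_) T)     ≡⟨ cong₂ _+_ (length-map _ S) (length-map _ T) ⟩
  length S + length T                                          ≡⟨ cong₂ _+_ (length-subsetsOfSize n j) (length-subsetsOfSize n (suc j)) ⟩
  n C j + n C suc j                                            ≡⟨ nCk+nC[k+1]≡[n+1]C[k+1] n j ⟩
  suc n C suc j                                                ∎
  where
  open ≡-Reasoning
  S = subsetsOfSize n j
  T = subsetsOfSize n (suc j)

∈-subsetsOfSize : ∀ {n} (e : Subset n) → e ∈ subsetsOfSize n ∣ e ∣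
∈-subsetsOfSize []            = here refl
∈-subsetsOfSize (inside ∷ e)  = ∈-++⁺ˡ (∈-map⁺ (inside ∷_) (∈-subsetsOfSize e))
∈-subsetsOfSize {suc n} (outside ∷ e) with ∣ e ∣ | ∈-subsetsOfSize e
... | zero  | e∈ = ∈-map⁺ (outside ∷_) e∈
... | suc j | e∈ = ∈-++⁺ʳ (map (inside ∷_) (subsetsOfSize n j)) (∈-map⁺ (outside ∷_) e∈)

nCk≤n^k : ∀ n j → n C j ≤ n ^ j
nCk≤n^k n       zero    = ≤-refl
nCk≤n^k zero    (suc j) = z≤n
nCk≤n^k (suc n) (suc j) = begin
  suc n C suc j              ≡⟨ nCk+nC[k+1]≡[n+1]C[k+1] n j ⟨
  n C j + n C suc j          ≤⟨ +-mono-≤ (nCk≤n^k n j) (nCk≤n^k n (suc j)) ⟩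
  n ^ j + n * n ^ j          ≤⟨ *-monoʳ-≤ (suc n) (^-monoˡ-≤ j (n≤1+n n)) ⟩
  suc n ^ suc j              ∎
  where open ≤-Reasoning

-- Greedy deletion

module Peeling {A I : Set} {K : I → Set} (_≟I_ : DecidableEquality I) (_≟K_ : ∀ {i} → DecidableEquality (K i))
               (key : ∀ i → A → K i) (d : I → ℕ) where

  fibre : (i : I) → K i → List A → ℕ
  fibre i b = count (λ a → key i a ≟K b)

  -- The analogue of a subgraph of large minimum degree, with the fibres of the keys in the role of
  -- degrees.
  Core : List A → Set
  Core xs = ∀ {a} → a ∈ xs → ∀ i → d i < fibre i (key i a) xs

  Charged : (i : I) → K i → Pred (I × A) 0ℓ
  Charged i b (j , a) = i ≡ j × key i a ≡ b

  charged? : (i : I) (b : K i) → Decidable (Charged i b)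
  charged? i b (j , a) = (i ≟I j) ×-dec (key i a ≟K b)

  hasIndex? : (i : I) → Decidable (λ (c : I × A) → i ≡ proj₁ c)
  hasIndex? i c = i ≟I proj₁ c

  -- The record of a deletion that leaves nothing. Each element is labelled with an index `i` whose
  -- fibre through it had at most `d i` elements when it was deleted.
  record Charging (xs : List A) : Set where
    field
      charges : List (I × A)
      perm    : map proj₂ charges ↭ xs
      bounded : ∀ i b → count (charged? i b) charges ≤ d i

    part : I → List A
    part i = map proj₂ (filter (hasIndex? i) charges)

    ∈-part : ∀ i {a} → a ∈ part i → a ∈ xs
    ∈-part i a∈ with ∈-map∘filter⁻ proj₂ (hasIndex? i) {xs = charges} a∈
    ... | c , c∈ , refl , _ = Perm.∈-resp-↭ perm (∈-map⁺ proj₂ c∈)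

    part-unique : Unique xs → ∀ i → Unique (part i)
    part-unique uniq i = go charges (unique-resp-↭ (↭-sym perm) uniq)
      where
      go : ∀ cs → Unique (map proj₂ cs) → Unique (map proj₂ (filter (hasIndex? i) cs))
      go [] _ = []
      go (c ∷ cs) (c∉ ∷ u) with i ≟I proj₁ c
      ... | no _  = go cs u
      ... | yes _ = All.tabulate (λ {a} a∈ → All.lookup c∉ (sub a∈)) ∷ go cs u
        where
        sub : ∀ {a} → a ∈ map proj₂ (filter (hasIndex? i) cs) → a ∈ map proj₂ cs
        sub a∈ with ∈-map∘filter⁻ proj₂ (hasIndex? i) {xs = cs} a∈
        ... | c′ , c′∈ , refl , _ = ∈-map⁺ proj₂ c′∈

    count-part : {P : Pred A 0ℓ} (P? : Decidable P) → ∀ i → count P? (part i) ≤ count P? xs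
    count-part P? i = begin
      count P? (part i)                 ≡⟨ count-map P? proj₂ (filter (hasIndex? i) charges) ⟩
      count (P? ∘ proj₂) (filter (hasIndex? i) charges)
                                        ≤⟨ count-filter-≤ (P? ∘ proj₂) _ charges ⟩
      count (P? ∘ proj₂) charges        ≡⟨ count-map P? proj₂ charges ⟨
      count P? (map proj₂ charges)      ≡⟨ count-↭ P? perm ⟩
      count P? xs                       ∎
      where open ≤-Reasoning

    fibre-part : ∀ i b → fibre i b (part i) ≤ d i
    fibre-part i b = ≤-trans (≤-reflexive (trans (count-map (λ a → key i a ≟K b) proj₂ (filter (hasIndex? i) charges)) (go charges))) (bounded i b)
      where
      go : ∀ cs → count (λ c → key i (proj₂ c) ≟K b) (filter (hasIndex? i) cs) ≡ count (charged? i b) cs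
      go [] = refl
      go ((j , a) ∷ cs) with i ≟I j
      ... | no _ = go cs
      ... | yes _ with key i a ≟K b
      ...   | yes _ = cong suc (go cs)
      ...   | no _  = go cs

    length-part≤ : ∀ i (ks : List (K i)) → (∀ {a} → a ∈ part i → key i a ∈ ks) → length (part i) ≤ length ks * d i
    length-part≤ i ks complete =
      length≤cover (λ b a → key i a ≟K b) ks (part i) complete (λ {b} _ → fibre-part i b)

    length-charges : length xs ≡ length charges
    length-charges = trans (sym (Perm.↭-length perm)) (length-map proj₂ charges)

    length≤parts : (is : List I) → (∀ i → i ∈ is) → {q : ℕ} → (∀ i → length (part i) ≤ q) → length xs ≤ length is * q
    length≤parts is complete small = subst (_≤ _) (sym length-charges)
      (length≤cover (λ i c → i ≟I proj₁ c) is charges (λ {c} _ → Any.map sym (complete (proj₁ c)))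
        (λ {i} _ → subst (_≤ _) (length-map proj₂ (filter (hasIndex? i) charges)) (small i)))

  -- Elements are charged in reverse order of deletion, so everything charged so far is still in the
  -- family. All charges to the key of `a` thus lie in one fibre, which is small by hypothesis;
  -- other keys gain nothing.
  charge : ∀ {ys zs : List A} {a} i → fibre i (key i a) (ys ++ a ∷ zs) ≤ d i →
           Charging (ys ++ zs) → Charging (ys ++ a ∷ zs)
  charge {ys} {zs} {a} i few C = record
    { charges = (i , a) ∷ charges ; perm = perm′ ; bounded = bounded′ }
    where
    open Charging C
    perm′ : a ∷ map proj₂ charges ↭ ys ++ a ∷ zs
    perm′ = ↭-trans (prep a perm) (↭-sym (Perm.shift a ys zs))
    bounded′ : ∀ j b → count (charged? j b) ((i , a) ∷ charges) ≤ d j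
    bounded′ j b with charged? j b (i , a)
    ... | no ¬p = subst (_≤ d j) (sym (count-reject (charged? j b) ¬p)) (bounded j b)
    ... | yes (refl , refl) = begin
      count (charged? i b) ((i , a) ∷ charges)              ≤⟨ count-mono (charged? i b) (λ c → key i (proj₂ c) ≟K b) ((i , a) ∷ charges) (λ _ → proj₂) ⟩
      count (λ c → key i (proj₂ c) ≟K b) ((i , a) ∷ charges) ≡⟨ count-map (λ a → key i a ≟K b) proj₂ ((i , a) ∷ charges) ⟨
      fibre i b (map proj₂ ((i , a) ∷ charges))             ≡⟨ count-↭ (λ a → key i a ≟K b) perm′ ⟩
      fibre i b (ys ++ a ∷ zs)                              ≤⟨ few ⟩
      d i                                                   ∎
      where open ≤-Reasoning

  NonemptyCore : List A → Set
  NonemptyCore xs = ∃₂ λ a ys → (a ∈ ys) × Unique ys × (∀ {b} → b ∈ ys → b ∈ xs) × Core ys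

  -- An element violating the core condition is deleted as long as there is one; `go` recurses on an
  -- upper bound `m` for the length.
  peel : (is : List I) → (∀ i → i ∈ is) → (xs : List A) → Unique xs → NonemptyCore xs ⊎ Charging xs
  peel is complete xs uniq = go (length xs) xs ≤-refl uniq
    where
    go : ∀ m xs → length xs ≤ m → Unique xs → NonemptyCore xs ⊎ Charging xs
    go m [] _ _ = inj₂ (record { charges = [] ; perm = ↭-refl ; bounded = λ _ _ → z≤n })
    go (suc m) xs@(x ∷ _) xs≤m uniq
      with All.all? (λ a → All.all? (λ i → d i <? fibre i (key i a) xs) is) xs
    ... | yes core = inj₁ (x , xs , here refl , uniq , id ,
                           λ a∈ i → All.lookup (All.lookup core a∈) (complete i))
    ... | no ¬core
      with a , a∈ , ¬a ← find (All.¬All⇒Any¬ (λ a → All.all? (λ i → d i <? fibre i (key i a) xs) is) xs ¬core)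
      with i , _ , few ← find (All.¬All⇒Any¬ (λ i → d i <? fibre i (key i a) xs) is ¬a)
      with ys , zs , eq ← ∈-∃++ a∈
      with go m (ys ++ zs)
             (≤-pred (subst (_≤ suc m) (trans (cong length eq) (Perm.↭-length (Perm.shift a ys zs))) xs≤m))
             (tailU (unique-resp-↭ (Perm.shift a ys zs) (subst Unique eq uniq)))
      where
      tailU : ∀ {y ys} → Unique (y ∷ ys) → Unique ys
      tailU (_ ∷ u) = u
    ... | inj₁ (b , ws , b∈ , u , sub , core) =
      inj₁ (b , ws , b∈ , u , (λ c∈ → subst (_ ∈_) (sym eq) (Perm.∈-resp-↭ (↭-sym (Perm.shift a ys zs)) (there (sub c∈)))) , core)
    ... | inj₂ C = inj₂ (subst Charging (sym eq)
                     (charge i (subst (λ l → fibre i (key i a) l ≤ d i) eq (≮⇒≥ few)) C))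

-- Linear paths

infix 4 _∈ₛ_ _∉ₛ_
_∈ₛ_ _∉ₛ_ : ∀ {n} → Fin n → Subset n → Set
_∈ₛ_ = Subset._∈_
_∉ₛ_ = Subset._∉_

tuple : ∀ {n} (e : Subset n) → Vec (Fin n) ∣ e ∣
tuple []            = []
tuple (inside ∷ e)  = zero ∷ Vec.map suc (tuple e)
tuple (outside ∷ e) = Vec.map suc (tuple e)

tuple-complete : ∀ {n} (e : Subset n) {x} → x ∈ₛ e → ∃ λ i → Vec.lookup (tuple e) i ≡ x
tuple-complete (inside ∷ e) {zero} x∈e = zero , refl
tuple-complete (inside ∷ e) {suc x} (Vec.there x∈e) with i , eq ← tuple-complete e x∈e =
  suc i , trans (Vec.lookup-map i suc (tuple e)) (cong suc eq)
tuple-complete (outside ∷ e) {suc x} (Vec.there x∈e) with i , eq ← tuple-complete e x∈e =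
  i , trans (Vec.lookup-map i suc (tuple e)) (cong suc eq)

tuple-sound : ∀ {n} (e : Subset n) i → Vec.lookup (tuple e) i ∈ₛ e
tuple-sound (inside ∷ e) zero = Vec.here
tuple-sound (inside ∷ e) (suc i) =
  subst (_∈ₛ inside ∷ e) (sym (Vec.lookup-map i suc (tuple e))) (Vec.there (tuple-sound e i))
tuple-sound (outside ∷ e) i =
  subst (_∈ₛ outside ∷ e) (sym (Vec.lookup-map i suc (tuple e))) (Vec.there (tuple-sound e i))

elements : ∀ {n} → Subset n → List (Fin n)
elements e = map (Vec.lookup (tuple e)) (allFin ∣ e ∣)

length-elements : ∀ {n} (e : Subset n) → length (elements e) ≡ ∣ e ∣
length-elements e = trans (length-map _ (allFin ∣ e ∣)) (length-tabulate id)

∈-elements : ∀ {n} (e : Subset n) {x} → x ∈ₛ e → x ∈ elements e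
∈-elements e x∈e with i , refl ← tuple-complete e x∈e = ∈-map⁺ _ (∈-allFin i)

vertices : ∀ {n} → List (Subset n) → List (Fin n)
vertices = concatMap elements

∈-vertices : ∀ {n} {e : Subset n} {es x} → e ∈ es → x ∈ₛ e → x ∈ vertices es
∈-vertices {e = e} e∈es x∈e = ∈-concatMap⁺ elements (Any.map (λ { refl → ∈-elements e x∈e }) e∈es)

length-vertices : ∀ {n k} {es : List (Subset n)} → All (λ e → ∣ e ∣ ≡ k) es →
                  length (vertices es) ≡ length es * k
length-vertices [] = refl
length-vertices {es = e ∷ es} (size ∷ sizes) =
  trans (length-++ (elements e)) (cong₂ _+_ (trans (length-elements e) size) (length-vertices sizes))

data LinearPath {n : ℕ} : List (Subset n) → Set where
  []   : LinearPath []
  [-]  : ∀ {e} → LinearPath [ e ]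
  path : ∀ {f e es} → ∣ f ∩ e ∣ ≡ 1 → All (λ g → Empty (f ∩ g)) es →
         LinearPath (e ∷ es) → LinearPath (f ∷ e ∷ es)

isLinearPath : ∀ {n} {es : List (Subset n)} → LinearPath es → IsLinearPath (length es) (lookup es)
isLinearPath lp = consecutive lp , remote lp
  where
  consecutive : ∀ {es} → LinearPath es → ∀ i j → toℕ j ≡ suc (toℕ i) → ∣ lookup es i ∩ lookup es j ∣ ≡ 1
  consecutive [-] zero zero ()
  consecutive (path meet _ _) zero (suc zero) _ = meet
  consecutive (path _ _ lp) (suc i) (suc j) eq = consecutive lp i j (suc-injective eq)
  remote : ∀ {es} → LinearPath es → ∀ i j → suc (toℕ i) < toℕ j → Empty (lookup es i ∩ lookup es j)
  remote [-] zero zero ()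
  remote (path _ _ _) zero (suc zero) (s≤s ())
  remote {_ ∷ _ ∷ es} (path _ away _) zero (suc (suc j)) _ = All.lookup away (∈-lookup {xs = es} j)
  remote (path _ _ lp) (suc i) (suc j) (s≤s i<j) = remote lp i j i<j

containsLinearPath : ∀ {n ℓ} {es F : List (Subset n)} → length es ≡ ℓ → LinearPath es → All (_∈ F) es →
                     ContainsLinearPath ℓ F
containsLinearPath {es = es} refl lp es⊆F =
  lookup es , isLinearPath lp , λ i → All.lookup es⊆F (∈-lookup {xs = es} i)

meet-in-one : ∀ {n} {f e : Subset n} {x} → x ∈ₛ f → x ∈ₛ e → (∀ {y} → y ∈ₛ f → y ∈ₛ e → y ≡ x) → ∣ f ∩ e ∣ ≡ 1
meet-in-one {f = f} {e} {x} x∈f x∈e only = trans (cong ∣_∣ f∩e≡⁅x⁆) (Subset.∣⁅x⁆∣≡1 x)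
  where
  f∩e≡⁅x⁆ : f ∩ e ≡ ⁅ x ⁆
  f∩e≡⁅x⁆ = Subset.⊆-antisym
    (λ y∈ → let y∈f , y∈e = Subset.x∈p∩q⁻ f e y∈ in
            subst (_∈ₛ ⁅ x ⁆) (sym (only y∈f y∈e)) (Subset.x∈⁅x⁆ x))
    (λ y∈ → subst (_∈ₛ f ∩ e) (sym (Subset.x∈⁅y⁆⇒x≡y x y∈)) (Subset.x∈p∩q⁺ (x∈f , x∈e)))

-- All conditions on the new edge follow from one: apart from the joint `x`, which of the old edges
-- only `e` contains, it avoids every vertex used so far.
extend : ∀ {n} {f e : Subset n} {es x} → LinearPath (e ∷ es) → x ∈ₛ f → x ∈ₛ e → All (x ∉ₛ_) es →
         (∀ {y} → y ∈ₛ f → y ≢ x → y ∉ vertices (e ∷ es)) → LinearPath (f ∷ e ∷ es)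
extend {f = f} {e} {es} {x} lp x∈f x∈e x∉es avoid = path
  (meet-in-one x∈f x∈e only)
  (All.tabulate λ {g} g∈es → λ (y , y∈f∩g) →
    let y∈f , y∈g = Subset.x∈p∩q⁻ f g y∈f∩g in disjoint g∈es y∈f y∈g)
  lp
  where
  only : ∀ {y} → y ∈ₛ f → y ∈ₛ e → y ≡ x
  only {y} y∈f y∈e = decidable-stable (y Fin.≟ x) λ y≢x → avoid y∈f y≢x (∈-vertices {es = e ∷ es} (here refl) y∈e)
  disjoint : ∀ {g y} → g ∈ es → y ∈ₛ f → y ∈ₛ g → ⊥
  disjoint {g} {y} g∈es y∈f y∈g with y Fin.≟ x
  ... | yes refl = All.lookup x∉es g∈es y∈g
  ... | no y≢x = avoid y∈f y≢x (∈-vertices {es = e ∷ es} (there g∈es) y∈g)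

-- Pairs of vertices that lie in many edges

Link : ∀ {n} → ℕ → List (Subset n) → Fin n → Fin n → Set
Link {n} w F x y = (W : List (Fin n)) → length W ≤ w → x ∉ W → y ∉ W →
  ∃ λ f → f ∈ F × x ∈ₛ f × y ∈ₛ f × (∀ {z} → z ∈ₛ f → z ∉ W)

link-sym : ∀ {n w F} {x y : Fin n} → Link w F x y → Link w F y x
link-sym xy W W≤w y∉W x∉W with f , f∈F , x∈f , y∈f , avoid ← xy W W≤w x∉W y∉W = f , f∈F , y∈f , x∈f , avoid

module _ {n k w : ℕ} {F : List (Subset n)} (sizes : All (λ e → ∣ e ∣ ≡ k) F) where

  StartsAt : Fin n → List (Subset n) → Set
  StartsAt v []       = ⊤
  StartsAt v (e ∷ es) = v ∈ₛ e × All (v ∉ₛ_) es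

  -- Built from the far end. `W` collects the vertices already walked through, which later edges
  -- must avoid. Each step adds one vertex to `W`, and each edge has `k` vertices to be avoided by
  -- the edges before it; hence the budget `w`.
  expand : ∀ v vs (W : List (Fin n)) → Linked (Link w F) (v ∷ vs) → Unique (v ∷ vs) → All (_∉ W) (v ∷ vs) →
           length W + length vs + length vs * k ≤ w →
           ∃ λ es → length es ≡ length vs × All (_∈ F) es × LinearPath es × StartsAt v es ×
                    All (λ e → All (_∉ₛ e) W) es
  expand v [] W _ _ _ _ = [] , refl , [] , [] , tt , []
  expand v (u ∷ vs) W (uv ∷ linked) ((v≢u ∷ v∉vs) ∷ uniq) (v∉W ∷ u∉W ∷ vs∉W) small
    = let
      es , len , es⊆F , lp , starts , avoid =
        expand u vs (v ∷ W) linked uniq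
          (u∉v∷W ∷ All.tabulate λ {z} z∈ → λ { (here refl) → All.lookup v∉vs z∈ refl ; (there z∈W) → All.lookup vs∉W z∈ z∈W })
          small′
      -- A link only avoids sets that miss both of its ends, so the joint `u` is removed from the
      -- vertices of the tail; `v` is not among them because the tail avoids `v ∷ W`.
      f , f∈F , v∈f , u∈f , f-avoid = uv (W ++ filter (¬? ∘ (Fin._≟ u)) (vertices es)) (bound es len es⊆F)
             (λ v∈ → [ v∉W , (λ v∈′ → v∉vertices es avoid (proj₁ (∈-filter⁻ (¬? ∘ (Fin._≟ u)) {xs = vertices es} v∈′))) ]′ (∈-++⁻ W v∈))
             (λ u∈ → [ u∉W , (λ u∈′ → proj₂ (∈-filter⁻ (¬? ∘ (Fin._≟ u)) {xs = vertices es} u∈′) refl) ]′ (∈-++⁻ W u∈))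
    in f ∷ es , cong suc len , f∈F ∷ es⊆F , lp′ es lp starts u∈f f-avoid
    , (v∈f , All.map All.head avoid)
    , All.tabulate (λ z∈W z∈f → f-avoid z∈f (∈-++⁺ˡ z∈W)) ∷ All.map All.tail avoid
    where
    open ≤-Reasoning
    u∉v∷W : u ∉ v ∷ W
    u∉v∷W (here u≡v)  = v≢u (sym u≡v)
    u∉v∷W (there u∈W) = u∉W u∈W
    small′ : length (v ∷ W) + length vs + length vs * k ≤ w
    small′ = begin
      suc (length W) + length vs + length vs * k      ≡⟨ cong (_+ length vs * k) (+-suc (length W) (length vs)) ⟨
      length W + suc (length vs) + length vs * k      ≤⟨ +-monoʳ-≤ (length W + suc (length vs)) (m≤n+m _ k) ⟩
      length W + suc (length vs) + (k + length vs * k) ≤⟨ small ⟩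
      w                                               ∎
    bound : ∀ es → length es ≡ length vs → All (_∈ F) es →
            length (W ++ filter (¬? ∘ (Fin._≟ u)) (vertices es)) ≤ w
    bound es len es⊆F = begin
      length (W ++ filter (¬? ∘ (Fin._≟ u)) (vertices es)) ≡⟨ length-++ W ⟩
      length W + length (filter (¬? ∘ (Fin._≟ u)) (vertices es)) ≤⟨ +-monoʳ-≤ (length W) (length-filter (¬? ∘ (Fin._≟ u)) (vertices es)) ⟩
      length W + length (vertices es)  ≡⟨ cong (length W +_) (length-vertices (All.map (All.lookup sizes) es⊆F)) ⟩
      length W + length es * k         ≡⟨ cong (λ m → length W + m * k) len ⟩
      length W + length vs * k         ≤⟨ +-mono-≤ (m≤m+n (length W) (suc (length vs))) (m≤n+m (length vs * k) k) ⟩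
      length W + suc (length vs) + (k + length vs * k) ≤⟨ small ⟩
      w                                ∎
    v∉vertices : ∀ es → All (λ e → All (_∉ₛ e) (v ∷ W)) es → v ∉ vertices es
    v∉vertices es avoid v∈ with find (∈-concatMap⁻ elements {xs = es} v∈)
    ... | e , e∈ , v∈e with i , _ , refl ← ∈-map⁻ (Vec.lookup (tuple e)) v∈e =
      All.head (All.lookup avoid e∈) (tuple-sound e i)
    lp′ : ∀ {f} es → LinearPath es → StartsAt u es → u ∈ₛ f →
          (∀ {z} → z ∈ₛ f → z ∉ W ++ filter (¬? ∘ (Fin._≟ u)) (vertices es)) → LinearPath (f ∷ es)
    lp′ []       _  _            _   _       = [-]
    lp′ (e ∷ es) lp (u∈e , u∉es) u∈f f-avoid = extend lp u∈f u∈e u∉es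
      λ y∈f y≢u y∈ → f-avoid y∈f (∈-++⁺ʳ W (∈-filter⁺ (¬? ∘ (Fin._≟ u)) y∈ y≢u))

-- Long paths by rotation

module Rotation {V : Set} (_≟_ : DecidableEquality V)
                {Adj : V → V → Set} (Adj-sym : ∀ {x y} → Adj x y → Adj y x)
                {Rich : V → Set} (rich? : Decidable Rich) (t : ℕ) where

  open import Data.List.Membership.DecPropositional _≟_ using (_∈?_)

  -- In the application the rich vertices are the centres, and every other vertex of a centred edge
  -- of the core is attached.
  Attached : V → Set
  Attached x = ∃ λ ys → Unique ys × t < length ys × All (λ y → Rich y × Adj x y) ys

  -- An invariant of all walks below, because the far end is where the very last vertex is added.
  EndsRich : List V → Set
  EndsRich []           = ⊥
  EndsRich (x ∷ [])     = Rich x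
  EndsRich (x ∷ y ∷ xs) = EndsRich (y ∷ xs)

  endsRich-∷ : ∀ x {xs} → EndsRich xs → EndsRich (x ∷ xs)
  endsRich-∷ x {_ ∷ _} rich = rich

  endsRich-ʳ++ : ∀ xs {ys} → EndsRich ys → EndsRich (xs ʳ++ ys)
  endsRich-ʳ++ []       rich = rich
  endsRich-ʳ++ (x ∷ xs) {ys} rich = endsRich-ʳ++ xs (endsRich-∷ x {ys} rich)

  endsRich-suffix : ∀ xs {y ys} → EndsRich (xs ++ y ∷ ys) → EndsRich (y ∷ ys)
  endsRich-suffix []           rich = rich
  endsRich-suffix (x ∷ [])     rich = rich
  endsRich-suffix (x ∷ z ∷ xs) rich = endsRich-suffix (z ∷ xs) rich

  endsRich-split : ∀ {xs} → EndsRich xs → ∃₂ λ ys y → xs ≡ ys ∷ʳ y × Rich y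
  endsRich-split {x ∷ []} rich = [] , x , refl , rich
  endsRich-split {x ∷ _ ∷ _} rich with ys , y , eq , r ← endsRich-split rich = x ∷ ys , y , cong (x ∷_) eq , r

  linked-ʳ++ : ∀ xs {c acc} → Linked Adj (c ∷ xs) → Linked Adj (c ∷ acc) → Linked Adj (xs ʳ++ (c ∷ acc))
  linked-ʳ++ []       _           l′ = l′
  linked-ʳ++ (x ∷ xs) (cx ∷ l)    l′ = linked-ʳ++ xs l (Adj-sym cx ∷ l′)

  linked-prefix : ∀ xs {ys} → Linked Adj (xs ++ ys) → Linked Adj xs
  linked-prefix []           _        = []
  linked-prefix (x ∷ [])     _        = [-]
  linked-prefix (x ∷ y ∷ xs) (xy ∷ l) = xy ∷ linked-prefix (y ∷ xs) l

  linked-suffix : ∀ xs {ys} → Linked Adj (xs ++ ys) → Linked Adj ys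
  linked-suffix []             l        = l
  linked-suffix (x ∷ []) {[]}    _      = []
  linked-suffix (x ∷ []) {_ ∷ _} (_ ∷ l) = l
  linked-suffix (x ∷ y ∷ xs)   (_ ∷ l)  = linked-suffix (y ∷ xs) l

  record Path (m : ℕ) : Set where
    field
      walk     : List V
      size     : length walk ≡ m
      unique   : Unique walk
      linked   : Linked Adj walk
      endsRich : EndsRich walk
      degrees  : All (λ x → Rich x ⊎ Attached x) walk

  scan : {P : Pred V 0ℓ} → Decidable P → ∀ xs →
         (∃₂ λ q u → ∃₂ λ v r → xs ≡ q ++ u ∷ v ∷ r × P v × Rich u) ⊎ Linked (λ u v → P v → ¬ Rich u) xs
  scan P? []           = inj₂ []
  scan P? (x ∷ [])     = inj₂ [-]
  scan P? (x ∷ y ∷ xs) with P? y ×-dec rich? x | scan P? (y ∷ xs)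
  ... | yes (p , r) | _ = inj₁ ([] , x , y , xs , refl , p , r)
  ... | no _ | inj₁ (q , u , v , r , eq , p , rich) = inj₁ (x ∷ q , u , v , r , cong (x ∷_) eq , p , rich)
  ... | no ¬pr | inj₂ l = inj₂ ((λ p r → ¬pr (p , r)) ∷ l)

  -- No two consecutive entries satisfy `P` and the first one does not, so each entry satisfying `P`
  -- can be paired with its predecessor.
  count-alternating : {P : Pred V 0ℓ} (P? : Decidable P) → ∀ {x xs} → ¬ P x →
                      Linked (λ u v → P v → ¬ P u) (x ∷ xs) → 2 * count P? (x ∷ xs) ≤ length (x ∷ xs)
  count-alternating P? ¬px [-] rewrite filter-reject P? {xs = []} ¬px = z≤n
  count-alternating P? {x} ¬px (_∷_ {y = y} {xs} step l) rewrite filter-reject P? {xs = y ∷ xs} ¬px with P? y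
  count-alternating P? {x} ¬px (_∷_ {y = y} {xs} step l) | no ¬py =
    m≤n⇒m≤1+n (subst (λ ys → 2 * length ys ≤ _) (filter-reject P? ¬py) (count-alternating P? ¬py l))
  count-alternating P? {x} ¬px (_∷_ {y = y} {[]} step l) | yes py = ≤-refl
  count-alternating P? {x} ¬px (_∷_ {y = y} {z ∷ xs} step (step′ ∷ l)) | yes py =
    subst (_≤ suc (suc (length (z ∷ xs)))) (sym (*-suc 2 (count P? (z ∷ xs))))
      (s≤s (s≤s (count-alternating P? (λ pz → step′ pz py) l)))

  module _ (grow : ∀ {y} → Rich y → ∀ W → length W ≤ 2 * suc t → ∃ λ x → x ∉ W × Adj x y × Attached x) where

    extendRich : ∀ {m} y ys → m ≤ 2 * suc t → (p : Path m) → Path.walk p ≡ y ∷ ys → Rich y → Path (suc m)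
    extendRich y ys m≤ p refl rich
      with x , x∉ , xy , att ← grow rich (y ∷ ys) (subst (_≤ 2 * suc t) (sym (Path.size p)) m≤) = record
      { walk     = x ∷ y ∷ ys
      ; size     = cong suc (Path.size p)
      ; unique   = All.¬Any⇒All¬ (y ∷ ys) x∉ ∷ Path.unique p
      ; linked   = xy ∷ Path.linked p
      ; endsRich = Path.endsRich p
      ; degrees  = inj₂ att ∷ Path.degrees p }

    -- If the head b is not rich and its rich neighbours all lie on the walk, then either one of
    -- them comes right after a rich u, and reversing the initial segment b … u makes u the head,
    -- or each comes right after a vertex that is not rich, and the walk has 2 (t + 1) vertices.
    lengthen : ∀ {m} → m < 2 * suc t → Path m → Path (suc m)
    lengthen {m} m<N p = go (Path.walk p) refl
      where
      module P = Path p
      go : ∀ L → P.walk ≡ L → Path (suc m)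
      go [] eq = ⊥-elim (subst EndsRich eq P.endsRich)
      go (b ∷ vs) eq with rich? b | All.head (subst (All _) eq P.degrees)
      ... | yes rich | _ = extendRich b vs (<⇒≤ m<N) p eq rich
      ... | no ¬rich | inj₁ rich = contradiction rich ¬rich
      ... | no ¬rich | inj₂ (ys , ys-unique , t<ys , nbrs) with All.all? (_∈? (b ∷ vs)) ys
      ...   | no ¬all
        with y , y∈ , y∉ ← find (All.¬All⇒Any¬ (_∈? (b ∷ vs)) ys ¬all)
        with rich , by ← All.lookup nbrs y∈ = record
        { walk     = y ∷ b ∷ vs
        ; size     = cong suc (trans (cong length (sym eq)) P.size)
        ; unique   = All.¬Any⇒All¬ (b ∷ vs) y∉ ∷ subst Unique eq P.unique
        ; linked   = Adj-sym by ∷ subst (Linked Adj) eq P.linked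
        ; endsRich = subst EndsRich eq P.endsRich
        ; degrees  = inj₁ rich ∷ subst (All _) eq P.degrees }
      ...   | yes all with scan (_∈? ys) (b ∷ vs)
      ...     | inj₁ ([] , u , v , r , refl , v∈ys , rich) = contradiction rich ¬rich
      ...     | inj₁ (b ∷ q , u , v , r , refl , v∈ys , rich) =
        extendRich u (q ʳ++ (b ∷ v ∷ r)) (<⇒≤ m<N) rotated (++-ʳ++ q) rich
        where
        regroup : b ∷ q ++ u ∷ v ∷ r ≡ (b ∷ q ++ [ u ]) ++ v ∷ r
        regroup = cong (b ∷_) (sym (++-assoc q [ u ] (v ∷ r)))
        perm : P.walk ↭ (q ++ [ u ]) ʳ++ (b ∷ v ∷ r)
        perm = subst (_↭ _) (sym (trans eq regroup))
          (↭-trans (↭-sym (Perm.shift b (q ++ [ u ]) (v ∷ r))) (Perm.++↭ʳ++ (q ++ [ u ]) (b ∷ v ∷ r)))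
        old : Linked Adj ((b ∷ q ++ [ u ]) ++ v ∷ r)
        old = subst (Linked Adj) (trans eq regroup) P.linked
        rotated : Path m
        rotated = record
          { walk     = (q ++ [ u ]) ʳ++ (b ∷ v ∷ r)
          ; size     = trans (sym (Perm.↭-length perm)) P.size
          ; unique   = unique-resp-↭ perm P.unique
          ; linked   = linked-ʳ++ (q ++ [ u ]) (linked-prefix (b ∷ q ++ [ u ]) old)
                         (proj₂ (All.lookup nbrs v∈ys) ∷ linked-suffix (b ∷ q ++ [ u ]) old)
          ; endsRich = endsRich-ʳ++ (q ++ [ u ]) (endsRich-suffix (b ∷ q ++ [ u ]) (subst EndsRich (trans eq regroup) P.endsRich))
          ; degrees  = Perm.All-resp-↭ perm P.degrees }
      ...     | inj₂ alternating = contradiction m<N (≤⇒≯ (begin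
        2 * suc t                            ≤⟨ *-monoʳ-≤ 2 t<ys ⟩
        2 * length ys                        ≤⟨ *-monoʳ-≤ 2 (unique-⊆⇒length≤ _≟_ ys-unique
                                                  (λ y∈ → ∈-filter⁺ (_∈? ys) (All.lookup all y∈) y∈)) ⟩
        2 * count (_∈? ys) (b ∷ vs)          ≤⟨ count-alternating (_∈? ys) (λ b∈ → ¬rich (proj₁ (All.lookup nbrs b∈)))
                                                  (Linked.map (λ f v∈ u∈ → f v∈ (proj₁ (All.lookup nbrs u∈))) alternating) ⟩
        length (b ∷ vs)                      ≡⟨ trans (cong length (sym eq)) P.size ⟩
        m                                    ∎))
        where open ≤-Reasoning

    pathOfLength : ∀ {y} → Rich y → ∀ m → m < 2 * suc t → Path (suc m)
    pathOfLength {y} rich zero _ = record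
      { walk = [ y ] ; size = refl ; unique = [] ∷ [] ; linked = [-] ; endsRich = rich ; degrees = inj₁ rich ∷ [] }
    pathOfLength rich (suc m) m<N = lengthen m<N (pathOfLength rich m (<-trans (n<1+n m) m<N))

    -- `lengthen` stops at `2 * suc t` vertices. One more is gained at the far end, which is still
    -- rich: the walk is reversed and `grow` applied once more.
    longPath : ∀ {y} → Rich y → ∃ λ xs → length xs ≡ suc (2 * suc t) × Unique xs × Linked Adj xs
    longPath rich = go (Path.walk p) refl
      where
      -- `2 * suc t` is the successor of `t + suc (t + 0)`, so `p` has `2 * suc t` vertices.
      p = pathOfLength rich (t + suc (t + 0)) ≤-refl
      module P = Path p
      go : ∀ L → P.walk ≡ L → ∃ λ xs → length xs ≡ suc (2 * suc t) × Unique xs × Linked Adj xs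
      go L eq with ys , y , refl , rich ← endsRich-split {L} (subst EndsRich eq P.endsRich) =
        let x , x∉ , xy , _ = grow rich (reverse (ys ∷ʳ y)) (≤-reflexive size′) in
        x ∷ reverse (ys ∷ʳ y) , cong suc size′ ,
        All.¬Any⇒All¬ _ x∉ ∷ unique-resp-↭ (↭-sym (Perm.↭-reverse (ys ∷ʳ y))) (subst Unique eq P.unique) ,
        subst (λ zs → Linked Adj (x ∷ zs)) (sym (reverse-++ ys [ y ]))
          (xy ∷ subst (Linked Adj) (reverse-++ ys [ y ]) (reversed (ys ∷ʳ y) (subst (Linked Adj) eq P.linked)))
        where
        size′ : length (reverse (ys ∷ʳ y)) ≡ 2 * suc t
        size′ = trans (length-reverse (ys ∷ʳ y)) (trans (cong length (sym eq)) P.size)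
        reversed : ∀ xs → Linked Adj xs → Linked Adj (reverse xs)
        reversed []       _ = []
        reversed (x ∷ xs) l = linked-ʳ++ xs l [-]

-- Homogeneous families of tuples

lookup-removeAt : ∀ {m} (v : Vec A (suc m)) i j → Vec.lookup (removeAt v i) j ≡ Vec.lookup v (punchIn i j)
lookup-removeAt (x ∷ v)     zero    j       = refl
lookup-removeAt (x ∷ y ∷ v) (suc i) zero    = refl
lookup-removeAt (x ∷ y ∷ v) (suc i) (suc j) = lookup-removeAt (y ∷ v) i j

lookup-ext : ∀ {m} {v v′ : Vec A m} → (∀ i → Vec.lookup v i ≡ Vec.lookup v′ i) → v ≡ v′
lookup-ext {v = v} {v′} eq =
  trans (sym (Vec.tabulate∘lookup v)) (trans (Vec.tabulate-cong eq) (Vec.tabulate∘lookup v′))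

removeAt-agree : ∀ {m} (v v′ : Vec A (suc m)) {i j} → removeAt v i ≡ removeAt v′ i → i ≢ j →
                 Vec.lookup v j ≡ Vec.lookup v′ j
removeAt-agree v v′ eq i≢j =
  trans (sym (Vec.removeAt-punchOut v i≢j))
    (trans (cong (λ u → Vec.lookup u (punchOut i≢j)) eq) (Vec.removeAt-punchOut v′ i≢j))

removeAt²-agree : ∀ {m} (v v′ : Vec A (suc (suc m))) {p q j} →
                  removeAt (removeAt v p) q ≡ removeAt (removeAt v′ p) q → p ≢ j → punchIn p q ≢ j →
                  Vec.lookup v j ≡ Vec.lookup v′ j
removeAt²-agree v v′ {p} {q} eq p≢j pq≢j =
  trans (sym (Vec.removeAt-punchOut v p≢j))
    (trans (removeAt-agree (removeAt v p) (removeAt v′ p) eq q≢) (Vec.removeAt-punchOut v′ p≢j))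
  where
  q≢ : q ≢ punchOut p≢j
  q≢ q≡ = pq≢j (trans (cong (punchIn p) q≡) (Fin.punchIn-punchOut p≢j))

removeAt-cong : ∀ {m} (v v′ : Vec A (suc m)) i → (∀ j → j ≢ i → Vec.lookup v j ≡ Vec.lookup v′ j) →
                removeAt v i ≡ removeAt v′ i
removeAt-cong v v′ i agree = lookup-ext λ j →
  trans (lookup-removeAt v i j) (trans (agree (punchIn i j) (Fin.punchInᵢ≢i i j)) (sym (lookup-removeAt v′ i j)))

-- If nothing satisfies `P` the count is zero, so one member may be fixed with which the others are
-- compared.
count-by-member : {P : Pred A 0ℓ} (P? : Decidable P) {d : ℕ} (xs : List A) →
                  (∀ {x} → x ∈ xs → P x → count P? xs ≤ d) → count P? xs ≤ d
count-by-member P? xs bound with Any.any? P? xs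
... | yes any with x , x∈ , px ← find any = bound x∈ px
... | no ¬any = subst (_≤ _) (sym (cong length (filter-none P? (All.¬Any⇒All¬ xs ¬any)))) z≤n

if-dec : {P : Set} → Dec P → ℕ → ℕ → ℕ
if-dec (yes _) a b = a
if-dec (no _)  a b = b

if-dec-yes : {P : Set} (P? : Dec P) {a b : ℕ} → P → if-dec P? a b ≡ a
if-dec-yes (yes _) p = refl
if-dec-yes (no ¬p) p = contradiction p ¬p

if-dec-no : {P : Set} (P? : Dec P) {a b : ℕ} → ¬ P → if-dec P? a b ≡ b
if-dec-no (yes p) ¬p = contradiction p ¬p
if-dec-no (no _)  ¬p = refl

-- `κ` stands for k - 2, the number of entries left after blanking two, and `w` bounds the size of
-- the sets to be avoided.
module Positions (κ w : ℕ) where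

  k : ℕ
  k = suc (suc κ)

  Position : Set
  Position = Fin k

  -- inj₁ p blanks the position p, inj₂ (p , q) blanks the two positions p and punchIn p q.
  Blank : Set
  Blank = Position ⊎ (Position × Fin (suc κ))

  _≟B_ : DecidableEquality Blank
  _≟B_ = Sum.≡-dec Fin._≟_ (Product.≡-dec Fin._≟_ Fin._≟_)

  blanks : List Blank
  blanks = map inj₁ (allFin k) ++ map inj₂ (cartesianProduct (allFin k) (allFin (suc κ)))

  ∈-blanks : ∀ i → i ∈ blanks
  ∈-blanks (inj₁ p) = ∈-++⁺ˡ (∈-map⁺ inj₁ (∈-allFin p))
  ∈-blanks (inj₂ (p , q)) =
    ∈-++⁺ʳ (map inj₁ (allFin k)) (∈-map⁺ inj₂ (∈-cartesianProduct⁺ (∈-allFin p) (∈-allFin q)))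

  -- A set of size `w` excludes at most `w + w` combinations of one of two positions and a value
  -- there, each shared by at most `w` tuples.
  pairThreshold : ℕ
  pairThreshold = (w + w) * w

  -- The argument bounds the number of positions that may still be added to `U`. The factor
  -- `length blanks` is the pigeonhole loss in passing to the tuples charged to a single blank.
  excess : ℕ → ℕ
  excess zero    = length blanks * pairThreshold
  excess (suc m) = length blanks * (excess m + pairThreshold)

module Tuples (n κ w : ℕ) where

  open Positions κ w public

  open import Data.List.Membership.DecPropositional (Fin._≟_ {n}) using (_∈?_)

  Tuple : Set
  Tuple = Vec (Fin n) k

  Rest : Blank → Set
  Rest (inj₁ _) = Vec (Fin n) (suc κ)
  Rest (inj₂ _) = Vec (Fin n) κ

  blank : ∀ i → Tuple → Rest i
  blank (inj₁ p)       v = removeAt v p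
  blank (inj₂ (p , q)) v = removeAt (removeAt v p) q

  _≟V_ : ∀ {m} → DecidableEquality (Vec (Fin n) m)
  _≟V_ = Vec.≡-dec Fin._≟_

  _≟R_ : ∀ {i} → DecidableEquality (Rest i)
  _≟R_ {inj₁ _} = _≟V_
  _≟R_ {inj₂ _} = _≟V_

  -- A tuple always lies in its own fibre, so the threshold 0 imposes no condition. What remains is
  -- a condition on single positions outside `U` and on pairs inside `U`.
  threshold : Subset k → Blank → ℕ
  threshold U (inj₁ p)       = if-dec (p Subset.∈? U) 0 w
  threshold U (inj₂ (p , q)) = if-dec ((p Subset.∈? U) ×-dec (punchIn p q Subset.∈? U)) pairThreshold 0

  module Peel (U : Subset k) = Peeling {A = Tuple} {I = Blank} {K = Rest} _≟B_ (λ {i} → _≟R_ {i}) blank (threshold U)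

  -- The price of entering `U`: a position is added only after passing to tuples charged to it,
  -- whose fibres there are small.
  Thin : Subset k → List Tuple → Set
  Thin U ts = ∀ {p} → p ∈ₛ U → ∀ b → count (λ v → removeAt v p ≟V b) ts ≤ w

  record Homogeneous (U : Subset k) (ts : List Tuple) : Set where
    field
      unique : Unique ts
      thin   : Thin U ts
      core   : Peel.Core U ts

  Replaceable : Subset k → Pred Position 0ℓ → Position → Set
  Replaceable U Keep j = j ∉ₛ U ⊎ (j ∈ₛ U × ∃ λ q → q ∈ₛ U × j ≢ q × ¬ Keep q)

  module _ {U : Subset k} {ts : List Tuple} (hom : Homogeneous U ts) {W : List (Fin n)} (W≤w : length W ≤ w) where
    open Homogeneous hom

    -- More than `w` tuples of the family agree with `v` off `p`. Being distinct, they have distinct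
    -- entries at `p`, and `W` cannot contain all of these.
    replace-one : ∀ {v p} → v ∈ ts → p ∉ₛ U →
                  ∃ λ v′ → v′ ∈ ts × (∀ j → j ≢ p → Vec.lookup v′ j ≡ Vec.lookup v j) × Vec.lookup v′ p ∉ W
    replace-one {v} {p} v∈ p∉U with Any.any? (λ v′ → ¬? (Vec.lookup v′ p ∈? W)) M
      where M = filter (λ v′ → removeAt v′ p ≟V removeAt v p) ts
    ... | yes any with v′ , v′∈M , avoid ← find any
                  with v′∈ , eq ← ∈-filter⁻ (λ v′ → removeAt v′ p ≟V removeAt v p) {xs = ts} v′∈M =
      v′ , v′∈ , (λ j j≢p → removeAt-agree v′ v eq (j≢p ∘ sym)) , avoid
    ... | no ¬any = contradiction few (<⇒≱ many)
      where
      same? = λ v′ → removeAt v′ p ≟V removeAt v p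
      M = filter same? ts
      many : w < length M
      many = subst (_< length M) (if-dec-no (p Subset.∈? U) p∉U) (core v∈ (inj₁ p))
      few : length M ≤ w
      few = ≤-trans (length≤cover (λ b v′ → b Fin.≟ Vec.lookup v′ p) W M
              (λ {v′} v′∈ → Any.map sym (decidable-stable (Vec.lookup v′ p ∈? W) (λ ∉W → ¬any (Any.map (λ { refl → ∉W }) v′∈))))
              (λ {b} _ → count-unique-≤1 (λ v′ → b Fin.≟ Vec.lookup v′ p) (Unique.filter⁺ same? unique) λ {x} {y} x∈ y∈ bx by →
                 let _ , ex = ∈-filter⁻ same? {xs = ts} x∈ ; _ , ey = ∈-filter⁻ same? {xs = ts} y∈ in
                 lookup-ext λ j → agree x y (trans ex (sym ey)) (trans (sym bx) by) j))
            (≤-trans (≤-reflexive (*-identityʳ (length W))) W≤w)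
        where
        agree : ∀ x y → removeAt x p ≡ removeAt y p → Vec.lookup x p ≡ Vec.lookup y p → ∀ j → Vec.lookup x j ≡ Vec.lookup y j
        agree x y eq eqp j with p Fin.≟ j
        ... | yes refl = eqp
        ... | no p≢j = removeAt-agree x y eq p≢j

    -- More than `pairThreshold` tuples agree with `v` off `p` and `q`. Those that fail have an
    -- entry of `W` at `p` or at `q`, and thinness leaves at most `w` of them for each given entry.
    replace-two : ∀ {v p q} → v ∈ ts → p ∈ₛ U → q ∈ₛ U → p ≢ q →
                  ∃ λ v′ → v′ ∈ ts × (∀ j → j ≢ p → j ≢ q → Vec.lookup v′ j ≡ Vec.lookup v j) ×
                           Vec.lookup v′ p ∉ W × Vec.lookup v′ q ∉ W
    replace-two {v} {p} {q} v∈ p∈U q∈U p≢q with Any.any? (λ v′ → ¬? (Vec.lookup v′ p ∈? W) ×-dec ¬? (Vec.lookup v′ q ∈? W)) M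
      where M = filter (λ v′ → removeAt (removeAt v′ p) (punchOut p≢q) ≟V removeAt (removeAt v p) (punchOut p≢q)) ts
    ... | yes any with v′ , v′∈M , avoid ← find any
                  with v′∈ , eq ← ∈-filter⁻ (λ v′ → removeAt (removeAt v′ p) (punchOut p≢q) ≟V removeAt (removeAt v p) (punchOut p≢q)) {xs = ts} v′∈M =
      v′ , v′∈ , (λ j j≢p j≢q → removeAt²-agree v′ v eq (j≢p ∘ sym)
                   (λ pq≡j → j≢q (trans (sym pq≡j) (Fin.punchIn-punchOut p≢q)))) , avoid
    ... | no ¬any = contradiction few (<⇒≱ many)
      where
      o = punchOut p≢q
      same? = λ v′ → removeAt (removeAt v′ p) o ≟V removeAt (removeAt v p) o
      M = filter same? ts
      po≡q : punchIn p o ≡ q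
      po≡q = Fin.punchIn-punchOut p≢q
      many : pairThreshold < length M
      many = subst (_< length M)
        (if-dec-yes ((p Subset.∈? U) ×-dec (punchIn p o Subset.∈? U)) (p∈U , subst (_∈ₛ U) (sym po≡q) q∈U))
        (core v∈ (inj₂ (p , o)))
      Hit : Fin n ⊎ Fin n → Pred Tuple 0ℓ
      Hit (inj₁ b) v′ = b ≡ Vec.lookup v′ p
      Hit (inj₂ b) v′ = b ≡ Vec.lookup v′ q
      hit? : ∀ b → Decidable (Hit b)
      hit? (inj₁ b) v′ = b Fin.≟ Vec.lookup v′ p
      hit? (inj₂ b) v′ = b Fin.≟ Vec.lookup v′ q
      agree : ∀ {x y} → x ∈ M → y ∈ M → ∀ j → j ≢ p → j ≢ q → Vec.lookup x j ≡ Vec.lookup y j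
      agree {x} {y} x∈ y∈ j j≢p j≢q = removeAt²-agree x y
        (trans (proj₂ (∈-filter⁻ same? {xs = ts} x∈)) (sym (proj₂ (∈-filter⁻ same? {xs = ts} y∈))))
        (j≢p ∘ sym) (λ pq≡j → j≢q (trans (sym pq≡j) po≡q))
      -- Tuples of M with a prescribed entry at p differ at most at q, where the family is thin.
      hits : ∀ b → count (hit? b) M ≤ w
      hits (inj₁ b) = count-by-member (hit? (inj₁ b)) M λ {u} u∈ bu →
        ≤-trans (count-mono (hit? (inj₁ b)) (λ x → removeAt x q ≟V removeAt u q) M
                  (λ {x} x∈ bx → removeAt-cong x u q λ j j≢q → case-p x∈ u∈ (trans (sym bx) bu) j j≢q))
          (≤-trans (count-filter-≤ (λ x → removeAt x q ≟V removeAt u q) same? ts) (thin q∈U (removeAt u q)))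
        where
        case-p : ∀ {x u} → x ∈ M → u ∈ M → Vec.lookup x p ≡ Vec.lookup u p → ∀ j → j ≢ q → Vec.lookup x j ≡ Vec.lookup u j
        case-p x∈ u∈ eq j j≢q with j Fin.≟ p
        ... | yes refl = eq
        ... | no j≢p = agree x∈ u∈ j j≢p j≢q
      hits (inj₂ b) = count-by-member (hit? (inj₂ b)) M λ {u} u∈ bu →
        ≤-trans (count-mono (hit? (inj₂ b)) (λ x → removeAt x p ≟V removeAt u p) M
                  (λ {x} x∈ bx → removeAt-cong x u p λ j j≢p → case-q x∈ u∈ (trans (sym bx) bu) j j≢p))
          (≤-trans (count-filter-≤ (λ x → removeAt x p ≟V removeAt u p) same? ts) (thin p∈U (removeAt u p)))
        where
        case-q : ∀ {x u} → x ∈ M → u ∈ M → Vec.lookup x q ≡ Vec.lookup u q → ∀ j → j ≢ p → Vec.lookup x j ≡ Vec.lookup u j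
        case-q x∈ u∈ eq j j≢p with j Fin.≟ q
        ... | yes refl = eq
        ... | no j≢q = agree x∈ u∈ j j≢p j≢q
      covered : ∀ {v′} → v′ ∈ M → Any (λ b → Hit b v′) (map inj₁ W ++ map inj₂ W)
      covered {v′} v′∈ with Vec.lookup v′ p ∈? W | Vec.lookup v′ q ∈? W
      ... | yes p∈W | _       = Any.++⁺ˡ (Any.map⁺ (Any.map sym p∈W))
      ... | no _    | yes q∈W = Any.++⁺ʳ (map inj₁ W) (Any.map⁺ (Any.map sym q∈W))
      ... | no p∉W  | no q∉W  = contradiction (Any.map (λ { refl → p∉W , q∉W }) v′∈) ¬any
      few : length M ≤ pairThreshold
      few = begin
        length M                                              ≤⟨ length≤cover hit? (map inj₁ W ++ map inj₂ W) M covered (λ {b} _ → hits b) ⟩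
        length (map inj₁ W ++ map inj₂ W) * w                 ≡⟨ cong (_* w) (trans (length-++ (map inj₁ W)) (cong₂ _+_ (length-map inj₁ W) (length-map inj₂ W))) ⟩
        (length W + length W) * w                             ≤⟨ *-monoˡ-≤ w (+-mono-≤ W≤w W≤w) ⟩
        pairThreshold                                         ∎
        where open ≤-Reasoning

    -- Positions are treated one at a time. A replacement of two positions also changes `q`, which
    -- does no harm: `q` is not to be kept, and its new entry avoids `W` too.
    clear : {Keep : Pred Position 0ℓ} → Decidable Keep → (∀ j → ¬ Keep j → Replaceable U Keep j) →
            ∀ {v} → v ∈ ts →
            ∃ λ v′ → v′ ∈ ts × (∀ j → Keep j → Vec.lookup v′ j ≡ Vec.lookup v j) × (∀ j → ¬ Keep j → Vec.lookup v′ j ∉ W)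
    clear {Keep} keep? ok {v} v∈ = let v′ , v′∈ , kept , cleared = go (allFin k) in v′ , v′∈ , kept , λ j → cleared (∈-allFin j)
      where
      go : ∀ J → ∃ λ v′ → v′ ∈ ts × (∀ j → Keep j → Vec.lookup v′ j ≡ Vec.lookup v j) ×
                          (∀ {j} → j ∈ J → ¬ Keep j → Vec.lookup v′ j ∉ W)
      go [] = v , v∈ , (λ _ _ → refl) , λ ()
      go (i ∷ J) with v′ , v′∈ , kept , cleared ← go J with keep? i
      ... | yes i-kept = v′ , v′∈ , kept , λ { (here refl) ¬kept → contradiction i-kept ¬kept ; (there j∈) → cleared j∈ }
      ... | no ¬i-kept with ok i ¬i-kept
      ...   | inj₁ i∉U with v″ , v″∈ , same , i∉W ← replace-one v′∈ i∉U =
        v″ , v″∈ , (λ j j-kept → trans (same j (λ { refl → ¬i-kept j-kept })) (kept j j-kept)) , cleared′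
        where
        cleared′ : ∀ {j} → j ∈ i ∷ J → ¬ Keep j → Vec.lookup v″ j ∉ W
        cleared′ {j} j∈ ¬kept with j Fin.≟ i | j∈
        ... | yes refl | _         = i∉W
        ... | no j≢i   | here j≡i  = contradiction j≡i j≢i
        ... | no j≢i   | there j∈J = subst (_∉ W) (sym (same j j≢i)) (cleared j∈J ¬kept)
      ...   | inj₂ (i∈U , q , q∈U , i≢q , ¬q-kept) with v″ , v″∈ , same , i∉W , q∉W ← replace-two v′∈ i∈U q∈U i≢q =
        v″ , v″∈ , (λ j j-kept → trans (same j (λ { refl → ¬i-kept j-kept }) (λ { refl → ¬q-kept j-kept })) (kept j j-kept)) , cleared′
        where
        cleared′ : ∀ {j} → j ∈ i ∷ J → ¬ Keep j → Vec.lookup v″ j ∉ W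
        cleared′ {j} j∈ ¬kept with j Fin.≟ i | j Fin.≟ q | j∈
        ... | yes refl | _        | _         = i∉W
        ... | no _     | yes refl | _         = q∉W
        ... | no j≢i   | no _     | here j≡i  = contradiction j≡i j≢i
        ... | no j≢i   | no j≢q   | there j∈J = subst (_∉ W) (sym (same j j≢i j≢q)) (cleared j∈J ¬kept)

  HomogeneousSubfamily : List Tuple → Set
  HomogeneousSubfamily ts = ∃₂ λ U ts′ → ∃ λ v → v ∈ ts′ × (∀ {v′} → v′ ∈ ts′ → v′ ∈ ts) × Homogeneous U ts′

  -- Peeling yields a core or charges every tuple to some blank. In the second case pairs account
  -- for few tuples, so some position `p` outside `U` receives many. The tuples charged to `p` are
  -- thin there, and the argument is repeated for them with `p` added to `U`.
  homogeneousSubfamily : ∀ m U → k ≤ m + ∣ U ∣ → ∀ ts → Unique ts → Thin U ts →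
                         excess m * n ^ κ < length ts → HomogeneousSubfamily ts
  homogeneousSubfamily m U k≤ ts uniq thin large with Peel.peel U blanks ∈-blanks ts uniq
  ... | inj₁ (v , ts′ , v∈ , uniq′ , sub , core) = U , ts′ , v , v∈ , sub , record
    { unique = uniq′ ; core = core
    ; thin = λ p∈ b → ≤-trans (unique-⊆⇒count≤ _≟V_ _ uniq′ sub) (thin p∈ b) }
  ... | inj₂ charging = byCharging m k≤ large
    where
    open Peel.Charging U charging
    open ≤-Reasoning
    T = pairThreshold

    part-inactive : ∀ i → threshold U i ≡ 0 → length (part i) ≤ 0
    part-inactive i off = begin
      length (part i)                                    ≤⟨ length-part≤ i (map (blank i) (part i)) (∈-map⁺ (blank i)) ⟩
      length (map (blank i) (part i)) * threshold U i    ≡⟨ cong (length (map (blank i) (part i)) *_) off ⟩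
      length (map (blank i) (part i)) * 0                ≡⟨ *-zeroʳ (length (map (blank i) (part i))) ⟩
      0                                                  ∎

    part-pair : ∀ p q → length (part (inj₂ (p , q))) ≤ T * n ^ κ
    part-pair p q = begin
      length (part (inj₂ (p , q)))                                  ≤⟨ length-part≤ (inj₂ (p , q)) (allVecs (allFin n) κ) (λ _ → ∈-allVecs ∈-allFin _) ⟩
      length (allVecs (allFin n) κ) * threshold U (inj₂ (p , q))    ≤⟨ *-mono-≤ (≤-reflexive (trans (length-allVecs (allFin n) κ) (cong (_^ κ) (length-tabulate id)))) threshold≤ ⟩
      n ^ κ * T                                                     ≡⟨ *-comm (n ^ κ) T ⟩
      T * n ^ κ                                                     ∎
      where
      threshold≤ : threshold U (inj₂ (p , q)) ≤ T
      threshold≤ with (p Subset.∈? U) ×-dec (punchIn p q Subset.∈? U)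
      ... | yes _ = ≤-refl
      ... | no _  = z≤n

    enlarge : ∀ {p} → p ∉ₛ U → ∣ U ∣ < ∣ U ∪ ⁅ p ⁆ ∣
    enlarge {p} p∉U = Subset.p⊂q⇒∣p∣<∣q∣
      (Subset.p⊆p∪q ⁅ p ⁆ , p , Subset.q⊆p∪q U ⁅ p ⁆ (Subset.x∈⁅x⁆ p) , p∉U)

    small-parts : ∀ {q} → (∀ p → p ∉ₛ U → length (part (inj₁ p)) ≤ q) → T * n ^ κ ≤ q →
                  length ts ≤ length blanks * q
    small-parts {q} singles T≤q = length≤parts blanks ∈-blanks small
      where
      small : ∀ i → length (part i) ≤ q
      small (inj₂ (p , r)) = ≤-trans (part-pair p r) T≤q
      small (inj₁ p) with p Subset.∈? U
      ... | yes p∈ = ≤-trans (part-inactive (inj₁ p) (if-dec-yes (p Subset.∈? U) p∈)) z≤n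
      ... | no p∉  = singles p p∉

    byCharging : ∀ m → k ≤ m + ∣ U ∣ → excess m * n ^ κ < length ts → HomogeneousSubfamily ts
    -- Here `U` contains all positions, so only pairs can be charged.
    byCharging zero k≤ large = contradiction large (≤⇒≯ (begin
      length ts                    ≤⟨ small-parts (λ p p∉ → ⊥-elim (<⇒≱ (enlarge p∉) (≤-trans (Subset.∣p∣≤n (U ∪ ⁅ p ⁆)) k≤))) ≤-refl ⟩
      length blanks * (T * n ^ κ)  ≡⟨ *-assoc (length blanks) T (n ^ κ) ⟨
      excess zero * n ^ κ          ∎))
    byCharging (suc m) k≤ large
      with Fin.any? (λ p → ¬? (p Subset.∈? U) ×-dec (excess m * n ^ κ <? length (part (inj₁ p))))
    ... | yes (p , p∉ , large′) =
      let U′ , ts′ , v , v∈ , sub , hom = homogeneousSubfamily m (U ∪ ⁅ p ⁆)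
            (≤-trans k≤ (≤-trans (≤-reflexive (sym (+-suc m ∣ U ∣))) (+-monoʳ-≤ m (enlarge p∉))))
            (part (inj₁ p)) (part-unique uniq (inj₁ p)) thin′ large′
      in U′ , ts′ , v , v∈ , ∈-part (inj₁ p) ∘ sub , hom
      where
      thin′ : Thin (U ∪ ⁅ p ⁆) (part (inj₁ p))
      thin′ {q} q∈ b with Subset.x∈p∪q⁻ U ⁅ p ⁆ q∈
      ... | inj₁ q∈U = ≤-trans (count-part _ (inj₁ p)) (thin q∈U b)
      ... | inj₂ q∈p with refl ← Subset.x∈⁅y⁆⇒x≡y p q∈p =
        ≤-trans (fibre-part (inj₁ p) b) (≤-reflexive (if-dec-no (p Subset.∈? U) p∉))
    ... | no ¬large = contradiction large (≤⇒≯ (begin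
      length ts                                  ≤⟨ small-parts
                                                      (λ p p∉ → ≤-trans (≮⇒≥ (λ l → ¬large (p , p∉ , l))) (*-monoˡ-≤ (n ^ κ) (m≤m+n (excess m) T)))
                                                      (*-monoˡ-≤ (n ^ κ) (m≤n+m T (excess m))) ⟩
      length blanks * ((excess m + T) * n ^ κ)   ≡⟨ *-assoc (length blanks) (excess m + T) (n ^ κ) ⟨
      excess (suc m) * n ^ κ                     ∎))

-- Long paths or a central vertex

Represents : ∀ {n m} → Vec (Fin n) m → Subset n → Set
Represents v e = (∀ i → Vec.lookup v i ∈ₛ e) × (∀ {x} → x ∈ₛ e → ∃ λ i → Vec.lookup v i ≡ x)

represent : ∀ {n m} (e : Subset n) → ∣ e ∣ ≡ m → ∃ λ (v : Vec (Fin n) m) → Represents v e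
represent e refl = tuple e , tuple-sound e , tuple-complete e

represents-⊆ : ∀ {n m} (v : Vec (Fin n) m) {e e′} → Represents v e → Represents v e′ → e Subset.⊆ e′
represents-⊆ _ {e′ = e′} (_ , complete) (sound , _) x∈e with i , eq ← complete x∈e = subst (_∈ₛ e′) eq (sound i)

represents-injective : ∀ {n m} (v : Vec (Fin n) m) {e e′} → Represents v e → Represents v e′ → e ≡ e′
represents-injective v r r′ = Subset.⊆-antisym (represents-⊆ v r r′) (represents-⊆ v r′ r)

representAll : ∀ {n m} {R : List (Subset n)} → All (λ e → ∣ e ∣ ≡ m) R → Unique R →
               ∃ λ (ts : List (Vec (Fin n) m)) → length ts ≡ length R × Unique ts ×
                 (∀ {v} → v ∈ ts → ∃ λ e → e ∈ R × Represents v e)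
representAll [] _ = [] , refl , [] , λ ()
representAll {R = e ∷ R} (size ∷ sizes) (e∉R ∷ uniq)
  with v , rep ← represent e size
  with ts , len , ts-unique , reps ← representAll sizes uniq =
  v ∷ ts , cong suc len
  , All.tabulate (λ v′∈ → λ { refl → let e′ , e′∈ , rep′ = reps v′∈ in All.lookup e∉R e′∈ (represents-injective v rep rep′) })
    ∷ ts-unique
  , λ { (here refl) → e , here refl , rep ; (there v∈) → let e′ , e′∈ , rep′ = reps v∈ in e′ , there e′∈ , rep′ }

-- This is where k ≥ 4 enters: deleting `u` and `u′` leaves `2 + m` positions, and the first two of
-- them are taken.
twoOthers : ∀ {m} {u u′ : Fin (4 + m)} → u ≢ u′ →
            ∃₂ λ p q → p ≢ q × (p ≢ u × p ≢ u′) × (q ≢ u × q ≢ u′)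
twoOthers {m} {u} {u′} u≢u′ = at zero , at (suc zero) , distinct , away zero , away (suc zero)
  where
  o = punchOut u≢u′
  at : Fin (2 + m) → Fin (4 + m)
  at i = punchIn u (punchIn o i)
  distinct : at zero ≢ at (suc zero)
  distinct eq with () ← Fin.punchIn-injective o zero (suc zero) (Fin.punchIn-injective u _ _ eq)
  away : ∀ i → at i ≢ u × at i ≢ u′
  away i = Fin.punchInᵢ≢i u _ , λ eq →
    Fin.punchInᵢ≢i o i (Fin.punchIn-injective u _ _ (trans eq (sym (Fin.punchIn-punchOut u≢u′))))

Central : ∀ {n} → ℕ → List (Subset n) → Subset n → Fin n → Set
Central w F e y = y ∈ₛ e × (∀ {x} → x ∈ₛ e → x ≢ y → Link w F x y)

module Dichotomy (n k′ ℓ w : ℕ) (wide : suc ℓ * (4 + k′) ≤ w) {F : List (Subset n)}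
                 (sizes : All (λ e → ∣ e ∣ ≡ 4 + k′) F) where

  open Tuples n (2 + k′) w

  module _ {U : Subset k} {ts : List Tuple} (hom : Homogeneous U ts)
           (reps : ∀ {v} → v ∈ ts → ∃ λ e → e ∈ F × Represents v e) where

    -- `clear` keeps `c` and the position `i` of `x`; all other positions lie outside `U` and can be
    -- moved one at a time.
    central : ∀ {c v e} → (∀ {j} → j ∈ₛ U → j ≡ c) → v ∈ ts → Represents v e → Central w F e (Vec.lookup v c)
    central {c} {v} {e} only v∈ (sound , complete) = sound c , link
      where
      link : ∀ {x} → x ∈ₛ e → x ≢ Vec.lookup v c → Link w F x (Vec.lookup v c)
      link x∈e _ W W≤w x∉W y∉W with i , refl ← complete x∈e
        with v′ , v′∈ , kept , cleared ← clear hom W≤w {Keep = λ j → j ≡ i ⊎ j ≡ c} (λ j → (j Fin.≟ i) ⊎-dec (j Fin.≟ c))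
               (λ j ¬keep → inj₁ (λ j∈U → ¬keep (inj₂ (only j∈U)))) v∈
        with f , f∈F , sound′ , complete′ ← reps v′∈ =
        f , f∈F , subst (_∈ₛ f) (kept i (inj₁ refl)) (sound′ i) , subst (_∈ₛ f) (kept c (inj₂ refl)) (sound′ c) , avoid
        where
        avoid : ∀ {z} → z ∈ₛ f → z ∉ W
        avoid z∈f with j , refl ← complete′ z∈f with j Fin.≟ i | j Fin.≟ c
        ... | yes refl | _        = subst (_∉ W) (sym (kept j (inj₁ refl))) x∉W
        ... | no _     | yes refl = subst (_∉ W) (sym (kept j (inj₂ refl))) y∉W
        ... | no j≢i   | no j≢c   = cleared j [ j≢i , j≢c ]′

    module _ {u u′ : Position} (u∈U : u ∈ₛ U) (u′∈U : u′ ∈ₛ U) (u≢u′ : u ≢ u′) {v₀ : Tuple} (v₀∈ : v₀ ∈ ts) where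

      -- A position of `U` is moved together with `u`, and `u` itself together with `u′`; neither of
      -- the two is `p`.
      replaceable : ∀ {p} → p ≢ u × p ≢ u′ → ∀ j → j ≢ p → Replaceable U (_≡ p) j
      replaceable (p≢u , p≢u′) j j≢p with j Subset.∈? U | j Fin.≟ u
      ... | no j∉U  | _        = inj₁ j∉U
      ... | yes j∈U | yes refl = inj₂ (j∈U , u′ , u′∈U , u≢u′ , p≢u′ ∘ sym)
      ... | yes j∈U | no j≢u   = inj₂ (j∈U , u , u∈U , j≢u , p≢u ∘ sym)

      avoids : ∀ {p} {v v′ : Tuple} {W : List (Fin n)} {y} → (∀ j → j ≡ p → Vec.lookup v′ j ≡ Vec.lookup v j) →
               (∀ j → j ≢ p → Vec.lookup v′ j ∉ W) →
               (∃ λ i → Vec.lookup v′ i ≡ y) → y ≢ Vec.lookup v p → y ∉ W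
      avoids kept cleared (i , refl) y≢ = cleared i λ { refl → y≢ (kept i refl) }

      -- In a chain the newest edge meets the previous ones only in its entry at the joint p,
      -- so the next edge can be attached at any other position.
      chain : ∀ m → m ≤ ℓ → ∀ {p q} → p ≢ q → p ≢ u × p ≢ u′ → q ≢ u × q ≢ u′ →
              ∃₂ λ e es → ∃ λ v → length es ≡ m × LinearPath (e ∷ es) × All (_∈ F) (e ∷ es) × v ∈ ts × Represents v e ×
                All (λ g → ∀ i → i ≢ p → Vec.lookup v i ∉ₛ g) es
      chain zero _ _ _ _ with e , e∈F , rep ← reps v₀∈ = e , [] , v₀ , refl , [-] , e∈F ∷ [] , v₀∈ , rep , []
      chain (suc m) m<ℓ {p} {q} p≢q p-ok q-ok =
        -- The roles of `p` and `q` are swapped: the shorter chain has its joint at `q`, so the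
        -- entry of its newest edge at `p` lies on no earlier edge.
        let e , es , v , len , lp , ⊆F , v∈ , (sound , complete) , fresh = chain m (<⇒≤ m<ℓ) {q} {p} (p≢q ∘ sym) q-ok p-ok
            W≤w = subst (_≤ w) (sym (length-vertices (All.map (All.lookup sizes) ⊆F)))
                    (≤-trans (*-monoˡ-≤ k (s≤s (≤-trans (≤-reflexive len) (<⇒≤ m<ℓ)))) wide)
            v′ , v′∈ , kept , cleared = clear hom {vertices (e ∷ es)} W≤w {Keep = _≡ p} (Fin._≟ p) (replaceable p-ok) v∈
            f , f∈F , sound′ , complete′ = reps v′∈
        in f , e ∷ es , v′ , cong suc len
           , extend lp (subst (_∈ₛ f) (kept p refl) (sound′ p)) (sound p) (All.map (λ new → new p p≢q) fresh)
               (λ y∈f y≢ → avoids {v = v} {v′} kept cleared (complete′ y∈f) y≢)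
           , f∈F ∷ ⊆F , v′∈ , (sound′ , complete′)
           , All.tabulate (λ g∈ i i≢p i∈g → cleared i i≢p (∈-vertices {es = e ∷ es} g∈ i∈g))

      longChain : ContainsLinearPath (suc ℓ) F
      longChain with p , q , p≢q , p-ok , q-ok ← twoOthers u≢u′
                with e , es , v , len , lp , ⊆F , _ ← chain ℓ ≤-refl p≢q p-ok q-ok =
        containsLinearPath (cong suc len) lp ⊆F

  edgeOrPath : ∀ {R} → (∀ {e} → e ∈ R → e ∈ F) → ∀ {ts : List Tuple} → HomogeneousSubfamily ts →
               (∀ {v} → v ∈ ts → ∃ λ e → e ∈ R × Represents v e) →
               ContainsLinearPath (suc ℓ) F ⊎ (∃₂ λ e y → e ∈ R × Central w F e y)
  edgeOrPath {R} R⊆F (U , ts′ , v , v∈ , sub , hom) reps =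
    cases (Fin.any? λ u → Fin.any? λ u′ → (u Subset.∈? U) ×-dec (u′ Subset.∈? U) ×-dec ¬? (u Fin.≟ u′))
          (Subset.nonempty? U) (reps (sub v∈))
    where
    inF : ∀ {v} → v ∈ ts′ → ∃ λ e → e ∈ F × Represents v e
    inF v∈ = let e , e∈ , rep = reps (sub v∈) in e , R⊆F e∈ , rep
    cases : Dec (∃₂ λ u u′ → u ∈ₛ U × u′ ∈ₛ U × u ≢ u′) → Dec (Subset.Nonempty U) →
            (∃ λ e → e ∈ R × Represents v e) →
            ContainsLinearPath (suc ℓ) F ⊎ (∃₂ λ e y → e ∈ R × Central w F e y)
    cases (yes (u , u′ , u∈ , u′∈ , u≢u′)) _ _ = inj₁ (longChain hom inF u∈ u′∈ u≢u′ v∈)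
    cases (no none) (yes (c , c∈)) (e , e∈ , rep) =
      inj₂ (e , _ , e∈ , central hom inF (λ {j} j∈ → decidable-stable (j Fin.≟ c) (λ j≢c → none (j , c , j∈ , c∈ , j≢c))) v∈ rep)
    -- With `U` empty any position can serve as the centre.
    cases (no none) (no empty) (e , e∈ , rep) =
      inj₂ (e , _ , e∈ , central hom inF {c = zero} (λ {j} j∈ → contradiction (j , j∈) empty) v∈ rep)

  dichotomy : ∀ {R} → Unique R → (∀ {e} → e ∈ R → e ∈ F) → excess k * n ^ (2 + k′) < length R →
              ContainsLinearPath (suc ℓ) F ⊎ (∃₂ λ e y → e ∈ R × Central w F e y)
  dichotomy {R} uniq R⊆F large =
    let ts , len , ts-unique , reps = representAll (All.tabulate (λ e∈ → All.lookup sizes (R⊆F e∈))) uniq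
    in edgeOrPath R⊆F
         -- The start is the empty `U`, where thinness is vacuous and all `k` positions may still be
         -- added.
         (homogeneousSubfamily k Subset.⊥ (m≤m+n k _) ts ts-unique (λ p∈ → ⊥-elim (Subset.∉⊥ p∈))
           (subst (excess k * n ^ (2 + k′) <_) (sym len) large))
         reps

-- Counting centred edges

unique-map : (f : A → B) {xs : List A} → (∀ {x y} → x ∈ xs → y ∈ xs → f x ≡ f y → x ≡ y) →
             Unique xs → Unique (map f xs)
unique-map f inj [] = []
unique-map f {x ∷ xs} inj (x∉ ∷ uniq) =
  All.map⁺ (All.tabulate (λ y∈ fx≡fy → All.lookup x∉ y∈ (inj (here refl) (there y∈) fx≡fy))) ∷
  unique-map f (λ x∈ y∈ → inj (there x∈) (there y∈)) uniq

∣p-x∣ : ∀ {n} (p : Subset n) {x} → x ∈ₛ p → suc ∣ p - x ∣ ≡ ∣ p ∣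
∣p-x∣ (inside ∷ p)  Vec.here        = cong (suc ∘ ∣_∣) (Subset.p─⊥≡p p)
∣p-x∣ (inside ∷ p)  (Vec.there x∈p) = cong suc (∣p-x∣ p x∈p)
∣p-x∣ (outside ∷ p) (Vec.there x∈p) = ∣p-x∣ p x∈p

x∈p-y⇒x≢y : ∀ {n} (p : Subset n) {x y} → x ∈ₛ p - y → x ≢ y
x∈p-y⇒x≢y p {x} x∈ refl = <-irrefl (cong ∣_∣ (Subset.p─q─q≡p─q p ⁅ x ⁆)) (Subset.x∈p⇒∣p-x∣<∣p∣ x∈)

-- The trace of `e` on `W` as a bit vector, so that the possible traces can be counted.
code : ∀ {n} → (W : List (Fin n)) → Subset n → Vec Bool (length W)
code W e = Vec.map (Vec.lookup e) (fromList W)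

code-agree : ∀ {n} {W : List (Fin n)} {e e′ z} → code W e ≡ code W e′ → z ∈ W → z ∈ₛ e → z ∈ₛ e′
code-agree {e = e} {e′} {z} eq (here refl) z∈e =
  Vec.lookup⇒[]= z e′ (trans (sym (Vec.∷-injectiveˡ eq)) (Vec.[]=⇒lookup z∈e))
code-agree {W = _ ∷ W} {e} {e′} eq (there z∈) z∈e = code-agree {W = W} {e} {e′} (Vec.∷-injectiveʳ eq) z∈ z∈e

module CentredEdges (n k′ t : ℕ) {F : List (Subset n)} (sizes : All (λ e → ∣ e ∣ ≡ 4 + k′) F)
                    (uniq : Unique F) (free : ¬ ContainsLinearPath (2 * suc t) F) where

  open import Data.List.Membership.DecPropositional (Fin._≟_ {n}) using (_∈?_)

  -- `w` is the budget of `expand` for `ℓ` steps from an empty `W`, and it also covers the vertices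
  -- of `ℓ` edges, as `Dichotomy` requires. `rare` is the number of traces on `ℓ` vertices.
  k ℓ w rare : ℕ
  k = 4 + k′
  ℓ = 2 * suc t
  w = ℓ + ℓ * k
  rare = 2 ^ ℓ

  open Positions (2 + k′) w using (excess)

  CentredEdge : Set
  CentredEdge = Subset n × Fin n

  _≟E_ : DecidableEquality (Subset n)
  _≟E_ = Vec.≡-dec Bool._≟_

  -- Central edges are taken out of `R` one by one, each with one centre, until at most `x` edges
  -- are left.
  centre : ∀ {x} → (∀ {R} → Unique R → (∀ {e} → e ∈ R → e ∈ F) → x < length R → ∃₂ λ e y → e ∈ R × Central w F e y) →
           ∀ m R → length R ≤ m → Unique R → (∀ {e} → e ∈ R → e ∈ F) →
           ∃ λ (gs : List CentredEdge) → Unique gs × (∀ {g} → g ∈ gs → proj₁ g ∈ R × Central w F (proj₁ g) (proj₂ g)) ×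
             length R ≤ length gs + x
  centre {x} find-central m R R≤m uniq R⊆F with x <? length R
  ... | no few = [] , [] , (λ ()) , ≮⇒≥ few
  ... | yes many with find-central uniq R⊆F many
  centre find-central zero    [] R≤m uniq R⊆F | yes many | e , y , () , c
  centre find-central (suc m) R R≤m uniq R⊆F | yes many | e , y , e∈R , c with ∈-∃++ e∈R
  ... | xs , ys , refl with unique-resp-↭ (Perm.shift e xs ys) uniq
  ...   | e∉ ∷ uniq′ with centre find-central m (xs ++ ys) (≤-pred (subst (_≤ suc m) (Perm.↭-length (Perm.shift e xs ys)) R≤m)) uniq′
                            (λ z∈ → R⊆F (Perm.∈-resp-↭ (↭-sym (Perm.shift e xs ys)) (there z∈)))
  ...     | gs , gs-unique , good , R≤ =
    (e , y) ∷ gs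
    , All.tabulate (λ g∈ → λ { refl → All.lookup e∉ (proj₁ (good g∈)) refl }) ∷ gs-unique
    , (λ { (here refl) → e∈R , c ; (there g∈) → let g∈′ , c′ = good g∈ in Perm.∈-resp-↭ (↭-sym (Perm.shift e xs ys)) (there g∈′) , c′ })
    , ≤-trans (≤-reflexive (Perm.↭-length (Perm.shift e xs ys))) (s≤s R≤)

  -- Two kinds of degree: many edges over `e - y` make its vertices attached, and many edges at `y`
  -- let a rich vertex escape any `ℓ` given vertices.
  Key : Bool → Set
  Key true  = Subset n
  Key false = Fin n

  key : ∀ b → CentredEdge → Key b
  key true  (e , y) = e - y
  key false (e , y) = y

  _≟K_ : ∀ {b} → DecidableEquality (Key b)
  _≟K_ {true}  = _≟E_
  _≟K_ {false} = Fin._≟_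

  threshold : Bool → ℕ
  threshold true  = t
  threshold false = rare

  open Peeling Bool._≟_ (λ {b} → _≟K_ {b}) key threshold

  same-edge : ∀ {e e′ : Subset n} {y} → y ∈ₛ e → y ∈ₛ e′ → (∀ {z} → z ≢ y → z ∈ₛ e → z ∈ₛ e′) →
              (∀ {z} → z ≢ y → z ∈ₛ e′ → z ∈ₛ e) → e ≡ e′
  same-edge {e} {e′} {y} y∈e y∈e′ to from = Subset.⊆-antisym (half y∈e′ to) (half y∈e from)
    where
    half : ∀ {p q : Subset n} → y ∈ₛ q → (∀ {z} → z ≢ y → z ∈ₛ p → z ∈ₛ q) → p Subset.⊆ q
    half y∈q to {z} z∈p with z Fin.≟ y
    ... | yes refl = y∈q
    ... | no z≢y   = to z≢y z∈p

  module _ {gs : List CentredEdge} (gs-unique : Unique gs) (good : ∀ {g} → g ∈ gs → Central w F (proj₁ g) (proj₂ g)) where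

    module _ (core : Core gs) where

      Rich : Fin n → Set
      Rich y = y ∈ map proj₂ gs

      rich? : Decidable Rich
      rich? y = y ∈? map proj₂ gs

      open Rotation Fin._≟_ {Adj = Link w F} (λ {x} {y} → link-sym {x = x} {y}) rich? t

      -- The core has more than `t` centred edges over the same set `e - y`. Their centres are
      -- distinct, since this set and the centre determine the edge, and `x` is a vertex of each
      -- other than its centre.
      attached : ∀ {e y x} → (e , y) ∈ gs → x ∈ₛ e → x ≢ y → Attached x
      attached {e} {y} {x} g∈ x∈e x≢y =
        map proj₂ M , unique-map proj₂ inj (Unique.filter⁺ same? gs-unique)
        , subst (t <_) (sym (length-map proj₂ M)) (core g∈ true)
        , All.map⁺ (All.tabulate λ {g} g∈M → let g∈gs , eq = ∈-filter⁻ same? {xs = gs} g∈M in ∈-map⁺ proj₂ g∈gs , linked g g∈gs eq)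
        where
        same? = λ g → key true g ≟E (e - y)
        M = filter same? gs
        linked : ∀ g → g ∈ gs → key true g ≡ e - y → Link w F x (proj₂ g)
        linked (e′ , y′) g∈gs eq = proj₂ (good g∈gs) (Subset.p─q⊆p e′ ⁅ y′ ⁆ x∈e′-y′) (x∈p-y⇒x≢y e′ x∈e′-y′)
          where
          x∈e′-y′ : x ∈ₛ e′ - y′
          x∈e′-y′ = subst (x ∈ₛ_) (sym eq) (Subset.x∈p∧x≢y⇒x∈p-y x∈e x≢y)
        inj : ∀ {g h} → g ∈ M → h ∈ M → proj₂ g ≡ proj₂ h → g ≡ h
        inj {e₁ , z} {e₂ , _} g∈M h∈M refl
          with g∈gs , eq₁ ← ∈-filter⁻ same? {xs = gs} g∈M
          with h∈gs , eq₂ ← ∈-filter⁻ same? {xs = gs} h∈M = cong (_, z)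
            (same-edge (proj₁ (good g∈gs)) (proj₁ (good h∈gs)) (move (trans eq₁ (sym eq₂))) (move (trans eq₂ (sym eq₁))))
          where
          move : ∀ {p q : Subset n} → p - z ≡ q - z → ∀ {x} → x ≢ z → x ∈ₛ p → x ∈ₛ q
          move {q = q} eq x≢z x∈p = Subset.p─q⊆p q ⁅ z ⁆ (subst (_ ∈ₛ_) eq (Subset.x∈p∧x≢y⇒x∈p-y x∈p x≢z))

      -- If `W` contained all other vertices of the edges centred at `y`, these edges would be
      -- determined by their traces on `W`, of which there are at most `rare`.
      grow : ∀ {y} → Rich y → ∀ W → length W ≤ ℓ → ∃ λ x → x ∉ W × Link w F x y × Attached x
      grow {y} rich W W≤ℓ with ∈-map⁻ proj₂ rich
      ... | (e , _) , g∈ , refl = search (Any.any? (λ g → Fin.any? (λ x → (x Subset.∈? proj₁ g) ×-dec ¬? (x Fin.≟ y) ×-dec ¬? (x ∈? W))) M)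
        where
        same? = λ (g : CentredEdge) → proj₂ g Fin.≟ y
        M = filter same? gs
        search : Dec (Any (λ g → ∃ λ x → x ∈ₛ proj₁ g × x ≢ y × x ∉ W) M) → ∃ λ x → x ∉ W × Link w F x y × Attached x
        search (yes any) with find any
        ... | (e′ , _) , g∈M , x , x∈ , x≢y , x∉W with ∈-filter⁻ same? {xs = gs} g∈M
        ...   | g∈gs , refl = x , x∉W , proj₂ (good g∈gs) x∈ x≢y , attached g∈gs x∈ x≢y
        search (no none) = contradiction few (<⇒≱ (core g∈ false))
          where
          inside-W : ∀ {g} → g ∈ M → ∀ {x} → x ≢ y → x ∈ₛ proj₁ g → x ∈ W
          inside-W g∈M {x} x≢y x∈ = decidable-stable (x ∈? W)
            λ x∉W → none (Any.map (λ { refl → x , x∈ , x≢y , x∉W }) g∈M)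
          determined : ∀ {g h} → g ∈ M → h ∈ M → code W (proj₁ g) ≡ code W (proj₁ h) → g ≡ h
          determined {e₁ , y₁} {e₂ , y₂} g∈M h∈M eq
            with g∈gs , refl ← ∈-filter⁻ same? {xs = gs} g∈M
            with h∈gs , refl ← ∈-filter⁻ same? {xs = gs} h∈M = cong (_, y)
              (same-edge (proj₁ (good g∈gs)) (proj₁ (good h∈gs))
                (λ z≢y z∈ → code-agree eq (inside-W g∈M z≢y z∈) z∈)
                (λ z≢y z∈ → code-agree (sym eq) (inside-W h∈M z≢y z∈) z∈))
          open ≤-Reasoning
          few : length M ≤ rare
          few = begin
            length M                                          ≤⟨ length≤cover (λ b g → b ≟B code W (proj₁ g)) (allVecs (true ∷ false ∷ []) (length W)) M
                                                                   (λ {g} _ → Any.map sym (∈-allVecs ∈-bools (code W (proj₁ g))))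
                                                                   (λ {b} _ → count-unique-≤1 (λ g → b ≟B code W (proj₁ g)) (Unique.filter⁺ same? gs-unique)
                                                                      (λ g∈ h∈ bg bh → determined g∈ h∈ (trans (sym bg) bh))) ⟩
            length (allVecs (true ∷ false ∷ []) (length W)) * 1 ≡⟨ *-identityʳ _ ⟩
            length (allVecs (true ∷ false ∷ []) (length W))   ≡⟨ length-allVecs (true ∷ false ∷ []) (length W) ⟩
            2 ^ length W                                      ≤⟨ ^-monoʳ-≤ 2 W≤ℓ ⟩
            rare                                              ∎
            where
            _≟B_ = Vec.≡-dec Bool._≟_
            ∈-bools : ∀ b → b ∈ true ∷ false ∷ []
            ∈-bools true  = here refl
            ∈-bools false = there (here refl)

      coreImpossible : ∀ {g} → g ∈ gs → ⊥
      coreImpossible g∈ with longPath grow (∈-map⁺ proj₂ g∈)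
      ... | [] , () , _
      ... | v ∷ vs , len , vs-unique , linked
        with es , es-len , es⊆F , lp , _ ← expand {w = w} sizes v vs [] linked vs-unique (All.tabulate λ _ ())
               (≤-reflexive (cong (λ m → m + m * k) (suc-injective len))) =
        free (containsLinearPath (trans es-len (suc-injective len)) lp es⊆F)

  -- A nonempty core is impossible, so everything is charged: at most `t` edges to each (k-1)-set
  -- and at most `rare` to each vertex.
  length-centred : ∀ gs → Unique gs → (∀ {g} → g ∈ gs → proj₁ g ∈ F × Central w F (proj₁ g) (proj₂ g)) →
                   length gs ≤ (n C (3 + k′)) * t + n * rare
  length-centred gs gs-unique good with peel (true ∷ false ∷ []) (λ { true → here refl ; false → there (here refl) }) gs gs-unique
  ... | inj₁ (g , ys , g∈ , ys-unique , sub , core) =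
    ⊥-elim (coreImpossible ys-unique (proj₂ ∘ good ∘ sub) core g∈)
  ... | inj₂ charging = begin
    length gs                                               ≡⟨ length-charges ⟩
    length charges                                          ≡⟨ length-split (hasIndex? true) charges ⟩
    count (hasIndex? true) charges + count (¬? ∘ hasIndex? true) charges
                                                            ≤⟨ +-monoʳ-≤ (count (hasIndex? true) charges) (count-mono (¬? ∘ hasIndex? true) (hasIndex? false) charges
                                                                 λ { {true , _} _ ≢true → contradiction refl ≢true ; {false , _} _ _ → refl }) ⟩
    count (hasIndex? true) charges + count (hasIndex? false) charges
                                                            ≡⟨ cong₂ _+_ (length-map proj₂ (filter (hasIndex? true) charges)) (length-map proj₂ (filter (hasIndex? false) charges)) ⟨
    length (part true) + length (part false)                ≤⟨ +-mono-≤ (length-part≤ true (subsetsOfSize n (3 + k′)) sized) (length-part≤ false (allFin n) (λ _ → ∈-allFin _)) ⟩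
    length (subsetsOfSize n (3 + k′)) * t + length (allFin n) * rare
                                                            ≡⟨ cong₂ _+_ (cong (_* t) (length-subsetsOfSize n (3 + k′))) (cong (_* rare) (length-tabulate {n = n} id)) ⟩
    (n C (3 + k′)) * t + n * rare                           ∎
    where
    open ≤-Reasoning
    open Charging charging
    sized : ∀ {g} → g ∈ part true → key true g ∈ subsetsOfSize n (3 + k′)
    sized {e , y} g∈ = subst (λ j → e - y ∈ subsetsOfSize n j) (suc-injective (trans (∣p-x∣ e (proj₁ (proj₂ (good (∈-part true g∈))))) (All.lookup sizes (proj₁ (good (∈-part true g∈)))))) (∈-subsetsOfSize (e - y))

  length-free : length F ≤ (n C (3 + k′)) * t + n * rare + excess k * n ^ (2 + k′)
  length-free =
    let gs , gs-unique , good , F≤ = centre find-central (length F) F ≤-refl uniq id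
    in ≤-trans F≤ (+-monoˡ-≤ (excess k * n ^ (2 + k′)) (length-centred gs gs-unique good))
    where
    find-central : ∀ {R} → Unique R → (∀ {e} → e ∈ R → e ∈ F) → excess k * n ^ (2 + k′) < length R →
                   ∃₂ λ e y → e ∈ R × Central w F e y
    find-central uniq R⊆F many =
      [ (λ lp → contradiction lp free) , id ]′
        -- `ℓ` is the successor of `t + suc (t + 0)`, so the path offered by the dichotomy is the
        -- excluded one.
        (Dichotomy.dichotomy n k′ (t + suc (t + 0)) w (m≤n+m (ℓ * k) ℓ) sizes uniq R⊆F many)

-- The bound

shorten : ∀ {n ℓ} {F : List (Subset n)} → ContainsLinearPath (suc ℓ) F → ContainsLinearPath ℓ F
shorten (P , (meets , apart) , P⊆F) =
  P ∘ suc , ((λ i j eq → meets (suc i) (suc j) (cong suc eq)) , (λ i j lt → apart (suc i) (suc j) (s≤s lt))) , P⊆F ∘ suc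

-- Pascal's rule passes from n = `suc m` to n - 1 in the binomial coefficient; the surplus
-- `m C (2 + κ)` and the factor `suc m` are both at most `N`.
regroup : ∀ m κ t r x → ((suc m) C (suc (suc (suc κ)))) * t + suc m * r + x * suc m ^ (2 + κ) ≤
          t * (m C (3 + κ)) + (t + r + x) * suc m ^ (2 + κ)
regroup m κ t r x = begin
  (suc m C (3 + κ)) * t + suc m * r + x * N               ≡⟨ cong (λ b → b * t + suc m * r + x * N) (nCk+nC[k+1]≡[n+1]C[k+1] m (2 + κ)) ⟨
  (m C (2 + κ) + m C (3 + κ)) * t + suc m * r + x * N     ≤⟨ +-monoˡ-≤ (x * N) (+-mono-≤ (*-monoˡ-≤ t (+-monoˡ-≤ (m C (3 + κ)) binomial≤)) (*-monoˡ-≤ r linear≤)) ⟩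
  (N + m C (3 + κ)) * t + N * r + x * N                   ≡⟨ solve 5 (λ N B t r x → (N :+ B) :* t :+ N :* r :+ x :* N := t :* B :+ (t :+ r :+ x) :* N) refl N (m C (3 + κ)) t r x ⟩
  t * (m C (3 + κ)) + (t + r + x) * N                     ∎
  where
  open ≤-Reasoning
  open +-*-Solver
  N = suc m ^ (2 + κ)
  binomial≤ : m C (2 + κ) ≤ N
  binomial≤ = ≤-trans (nCk≤n^k m (2 + κ)) (^-monoˡ-≤ (2 + κ) (n≤1+n m))
  linear≤ : suc m ≤ N
  linear≤ = ≤-trans (≤-reflexive (sym (*-identityʳ (suc m)))) (*-monoʳ-≤ (suc m) (m^n>0 (suc m) (1 + κ)))

theorem4p5 : (k t : ℕ) → 4 ≤ k → 1 ≤ t →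
    (∀ n a b → IsEx k n (2 * t + 1) a → IsEx k n (2 * t + 2) b → a ≤ b) ×
    Σ ℕ (λ c → Σ ℕ (λ N → ∀ n → N ≤ n → ∀ b → IsEx k n (2 * t + 2) b →
    b ≤ t * ((n ∸ 1) C (k ∸ 1)) + c * n ^ (k ∸ 2)))
theorem4p5 (suc (suc (suc (suc k′)))) t (s≤s (s≤s (s≤s (s≤s z≤n)))) _ =
  -- `t` pays for replacing n by n - 1 in the binomial coefficient, `rare` for the edges charged to
  -- their centres, and `excess` for the edges left without a centre. From 1 on, n is a successor.
  monotone , t + rare + excess , 1 , bound
  where
  k = 4 + k′
  rare = 2 ^ (2 * suc t)
  excess = Positions.excess (2 + k′) (2 * suc t + 2 * suc t * k) k

  monotone : ∀ n a b → IsEx k n (2 * t + 1) a → IsEx k n (2 * t + 2) b → a ≤ b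
  monotone n a b ((F , (family , free) , refl) , _) (_ , maximal) =
    maximal F (family , λ lp → free (shorten (subst (λ ℓ → ContainsLinearPath ℓ F) (+-suc (2 * t) 1) lp)))

  bound : ∀ n → 1 ≤ n → ∀ b → IsEx k n (2 * t + 2) b → b ≤ t * ((n ∸ 1) C (3 + k′)) + (t + rare + excess) * n ^ (2 + k′)
  bound (suc m) _ b ((F , ((uniq , sizes) , free) , refl) , _) =
    ≤-trans (CentredEdges.length-free (suc m) k′ t sizes uniq free′) (regroup m k′ t rare excess)
    where
    free′ : ¬ ContainsLinearPath (2 * suc t) F
    free′ lp = free (subst (λ ℓ → ContainsLinearPath ℓ F) (trans (*-suc 2 t) (+-comm 2 (2 * t))) lp)
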